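{- Let $T$ be a non-star tree and let $x$ be any vertex of $T$. Then there exists a $(T,x)$-well 2-placement.
   Context: All graphs are finite, simple and undirected; $dist$ denotes distance in $T$ and $d(y)$ the degree of $y$ in $T$. A non-star tree is a tree that is not isomorphic to a star $K_{1,m}$ for any $m\ge 0$ (so it has at least $4$ vertices). A permutation $\sigma$ of $V(T)$ is a 2-placement of $T$ if for every edge $ab\in E(T)$, $\sigma(a)\sigma(b)\notin E(T)$. $T^k$ denotes the $k$-th power of $T$; $\sigma(T)\subseteq T^k$ means that for every edge $ab$ of $T$, $dist(\sigma(a),\sigma(b))\le k$. Cycles of $\sigma$ are those of its disjoint cycle decomposition. For a non-star tree $T$ and a vertex $x$, a fixed-point-free permutation $\sigma$ of $V(T)$ is a $(T,x)$-well 2-placement if: (1) $\sigma$ is a 2-placement of $T$; (2) $\sigma(T)\subseteq T^6$; (3) $dist(x,\sigma(x))\le 2$; (4) $dist(y,\sigma(y))\le 3$ for every neighbor $y$ of $x$; (5) $dist(y,\sigma(y))\le 4$ for every $y$ with $d(y)=1$; (6) every cycle of $\sigma$ has length at most $5$. -}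

module Defs where

open import Data.Fin.Base using (Fin; zero; suc)
open import Data.Fin.Permutation using (Permutation; Permutation′; _⟨$⟩ʳ_)
open import Data.List.Base using (List; []; _∷_; [_]; _++_; length; filter; allFin)
open import Data.List.Relation.Unary.Linked using (Linked)
open import Data.List.Relation.Unary.Unique.Propositional using (Unique)
open import Data.Nat.Base using (ℕ; zero; suc; _≤_; NonZero)
open import Data.Product.Base using (Σ-syntax; ∃-syntax; _×_)
open import Data.Empty using (⊥)
open import Function.Bundles using (_⇔_)
open import Level using (0ℓ)
open import Relation.Binary.Core using (Rel)
open import Relation.Binary.Definitions using (Decidable; Symmetric)
open import Relation.Binary.PropositionalEquality.Core using (_≡_; _≢_)
open import Relation.Nullary.Negation.Core using (¬_)
open import Relation.Nullary.Decidable.Core using (yes; no)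

-- Closed R-chains v₀ R v₁ R … R vₖ₋₁ R v₀ through distinct points, given by
-- the list v₀, …, vₖ₋₁.  Used both for cycles of graphs (R is adjacency) and
-- for cycles of permutations (R x y is σ x ≡ y).
Cyclic : {A : Set} → Rel A 0ℓ → List A → Set
Cyclic R []       = ⊥
Cyclic R (v ∷ vs) = Unique (v ∷ vs) × Linked R (v ∷ vs ++ [ v ])

record Graph (n : ℕ) : Set₁ where
  field
    Adj    : Rel (Fin n) 0ℓ
    adj?   : Decidable Adj
    sym    : Symmetric Adj
    irrefl : ∀ {v} → ¬ Adj v v

module _ {n : ℕ} (G : Graph n) where
  open Graph G

  data Walk : Fin n → Fin n → ℕ → Set where
    nil  : ∀ {v} → Walk v v zero
    cons : ∀ {u v w k} → Adj u v → Walk v w k → Walk u w (suc k)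

  -- dist(u , v) = d
  IsDist : Fin n → Fin n → ℕ → Set
  IsDist u v d = Walk u v d × (∀ {k} → Walk u v k → d ≤ k)

  -- dist(u , v) ≤ k; the distance exists and is unique in a connected graph.
  Dist≤ : Fin n → Fin n → ℕ → Set
  Dist≤ u v k = ∃[ d ] IsDist u v d × d ≤ k

  degree : Fin n → ℕ
  degree v = length (filter (adj? v) (allFin n))

  Connected : Set
  Connected = ∀ u v → ∃[ k ] Walk u v k

  Acyclic : Set
  Acyclic = ∀ vs → 3 ≤ length vs → ¬ Cyclic Adj vs

  record IsTree : Set where
    field
      nonempty  : NonZero n
      connected : Connected
      acyclic   : Acyclic

_≅_ : ∀ {m n} → Graph m → Graph n → Set
_≅_ {m} {n} G H =
  Σ[ f ∈ Permutation m n ]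
    (∀ u v → Graph.Adj G u v ⇔ Graph.Adj H (f ⟨$⟩ʳ u) (f ⟨$⟩ʳ v))

data StarAdj {m : ℕ} : Rel (Fin (suc m)) 0ℓ where
  centre-leaf : ∀ {i} → StarAdj zero (suc i)
  leaf-centre : ∀ {i} → StarAdj (suc i) zero

-- K₁,ₘ
star : ∀ m → Graph (suc m)
star m = record
  { Adj    = StarAdj
  ; adj?   = λ { zero    zero    → no λ ()
               ; zero    (suc j) → yes centre-leaf
               ; (suc i) zero    → yes leaf-centre
               ; (suc i) (suc j) → no λ ()
               }
  ; sym    = λ { centre-leaf → leaf-centre ; leaf-centre → centre-leaf }
  ; irrefl = λ ()
  }

record IsNonStarTree {n : ℕ} (T : Graph n) : Set where
  field
    isTree  : IsTree T
    nonStar : ∀ m → ¬ (T ≅ star m)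

module _ {n : ℕ} (σ : Permutation′ n) where

  FixedPointFree : Set
  FixedPointFree = ∀ v → σ ⟨$⟩ʳ v ≢ v

  -- Fixed points count as cycles of length 1.
  IsCycle : List (Fin n) → Set
  IsCycle = Cyclic (λ u v → σ ⟨$⟩ʳ u ≡ v)

module _ {n : ℕ} (T : Graph n) (σ : Permutation′ n) where
  open Graph T

  Is2Placement : Set
  Is2Placement = ∀ {a b} → Adj a b → ¬ Adj (σ ⟨$⟩ʳ a) (σ ⟨$⟩ʳ b)

  -- σ(T) ⊆ Tᵏ
  ImageInPower : ℕ → Set
  ImageInPower k = ∀ {a b} → Adj a b → Dist≤ T (σ ⟨$⟩ʳ a) (σ ⟨$⟩ʳ b) k

record IsWell2Placement {n : ℕ} (T : Graph n) (x : Fin n)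
                        (σ : Permutation′ n) : Set where
  open Graph T
  field
    fixedPointFree : FixedPointFree σ
    is2Placement   : Is2Placement T σ
    imageInPower   : ImageInPower T σ 6
    dist-root      : Dist≤ T x (σ ⟨$⟩ʳ x) 2
    dist-neighbour : ∀ {y} → Adj x y → Dist≤ T y (σ ⟨$⟩ʳ y) 3
    dist-leaf      : ∀ {y} → degree T y ≡ 1 → Dist≤ T y (σ ⟨$⟩ʳ y) 4
    cycles         : ∀ vs → IsCycle σ vs → length vs ≤ 5

-- Root T at x and cut it, from the leaves upwards, into groups of
-- vertices, each mapped to itself without fixed points.  All edges between two
-- groups then meet a single vertex p, and as p is moved no such edge is mapped
-- to an edge.  It remains to keep the moves short: if the top of a group moves
-- by at most 2 and the vertex from which it hangs by at most 3, the edge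
-- between them is mapped into T⁶.  A group is split off as soon as neither it
-- nor the rest is a star, so that it consists of a hub v with star branches
-- (x may lie in one of them).  Two leaves at the same vertex can be exchanged,
-- and two branches at v can be placed together without v; this leaves finitely
-- many small shapes, for which a search finds placements.
module Submission where

open import Defs
open import Data.Bool.Base using (Bool; true; false; T; not; _∧_; if_then_else_)
open import Data.Bool.ListAction using (any)
open import Data.Empty using (⊥-elim)
open import Data.Fin.Base using (Fin; zero; suc)
import Data.Fin.Properties as Fin
open import Data.Fin.Permutation using (Permutation′; permutation; _⟨$⟩ʳ_)
open import Data.List.Base
  using (List; []; _∷_; [_]; _++_; length; map; concat; concatMap; mapMaybe; fromMaybe; filterᵇ; allFin; lookup)
open import Data.List.Properties
  using (map-++; concat-map; concat-++; concatMap-++; mapMaybe-++; length-map; ++-assoc; ++-identityʳ)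
open import Data.List.Membership.Propositional using (_∈_; _∉_)
open import Data.List.Membership.Propositional.Properties
  using (∈-++⁺ˡ; ∈-++⁺ʳ; ∈-++⁻; ∈-map⁺; ∈-map⁻; ∈-concat⁺′; ∈-concat⁻′; ∈-∃++; ∈-allFin; ∈-lookup)
open import Data.List.Relation.Binary.Disjoint.Propositional using (Disjoint)
open import Data.List.Relation.Binary.Permutation.Propositional
  using (_↭_; ↭-refl; ↭-sym; ↭-trans; ↭-reflexive; ↭⇒↭ₛ; prep; swap)
open import Data.List.Relation.Binary.Permutation.Propositional.Properties
  using (∈-resp-↭; ++⁺; ++⁺ˡ; ++⁺ʳ; shift; shifts; ∷↭∷ʳ; ++-comm; mapMaybe-↭; ↭-length; ++-commutativeMonoid)
  renaming (map⁺ to ↭-map⁺)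
import Data.List.Relation.Binary.Permutation.Setoid.Properties as Permutationₛ
open import Data.List.Relation.Unary.All as All using (All; []; _∷_)
import Data.List.Relation.Unary.All.Properties as All
open import Data.List.Relation.Unary.AllPairs using ([]; _∷_)
open import Data.List.Relation.Unary.Any using (here; there; any?; index)
open import Data.List.Relation.Unary.Any.Properties using (lookup-index)
open import Data.List.Relation.Unary.Linked using (Linked; [-]; _∷_)
open import Data.List.Relation.Unary.Unique.Propositional using (Unique)
import Data.List.Relation.Unary.Unique.Propositional.Properties as Unique
open import Data.Maybe.Base using (Maybe; just; nothing; is-just; maybe′; _>>=_)
open import Data.Nat.Base using (ℕ; zero; suc; _+_; _≤_; z≤n; s≤s; _≡ᵇ_)
import Data.Nat.Properties as ℕ
open import Data.Product.Base using (Σ-syntax; ∃-syntax; _×_; _,_; proj₁; proj₂)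
open import Data.Product.Properties using (≡-dec)
open import Data.Sum.Base as Sum using (_⊎_; inj₁; inj₂)
open import Data.Unit.Base using (⊤; tt)
open import Function.Base using (_∘_; id)
open import Function.Bundles using (mk⇔)
open import Relation.Binary.PropositionalEquality
  using (_≡_; _≢_; refl; sym; trans; cong; cong₂; subst; subst₂; setoid)
open import Relation.Nullary using (¬_; Dec; yes; no)
open import Relation.Nullary.Decidable using (dec⇒maybe; map′; _×-dec_; _⊎-dec_; ¬?)

-- Placements

-- A star has no fixed-point-free 2-placement. Hence a star can neither be split off nor be left
-- behind; it is carried upwards until the piece around it stops being a star. The rooted statement
-- lets the induction run: a group is placed with its top as root, and the bound 2 asked of a root
-- is what 6 = 3 + 1 + 2 leaves for a top. The bound 3 has to be promised at a vertex before it is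
-- known what will hang there; `hang` items record these promises. They cannot be made everywhere,
-- as placing two branches together may push a centre by 4. So branches come in an open and a closed
-- form, and it suffices to keep two of them open. Once leaves and branches are removed in pairs,
-- five kinds of branches remain, and at most three branches: `S`, which may contain the root, `W`,
-- which prevents a star, and one left over from the pairing. This gives 5 * 4 * 6 = 120 shapes,
-- besides 25 pairs and 2 hubs with a single branch.

module _ {A : Set} where

  ++-unique⁻ : ∀ xs {ys : List A} → Unique (xs ++ ys) → Unique xs × Unique ys × Disjoint xs ys
  ++-unique⁻ []       u       = [] , u , λ { (() , _) }
  ++-unique⁻ (x ∷ xs) (p ∷ u) =
    let ux , uy , d = ++-unique⁻ xs u in
    All.++⁻ˡ xs p ∷ ux , uy ,
    λ { (here refl , y∈) → All.lookup (All.++⁻ʳ xs p) y∈ refl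
      ; (there x∈  , y∈) → d (x∈ , y∈) }

  unique-resp-↭ : ∀ {xs ys : List A} → xs ↭ ys → Unique xs → Unique ys
  unique-resp-↭ p = Permutationₛ.Unique-resp-↭ (setoid A) (↭⇒↭ₛ p)

  closing : A → List A → List (A × A)
  closing x []           = []
  closing x (a ∷ [])     = [ (a , x) ]
  closing x (a ∷ b ∷ as) = (a , b) ∷ closing x (b ∷ as)

  -- The pairs (u , σ u) of the permutation with the given cycles.
  steps : List A → List (A × A)
  steps []       = []
  steps (a ∷ as) = closing a (a ∷ as)

  allSteps : List (List A) → List (A × A)
  allSteps = concatMap steps

  closing-sources : ∀ x as → map proj₁ (closing x as) ≡ as
  closing-sources x []           = refl
  closing-sources x (a ∷ [])     = refl
  closing-sources x (a ∷ b ∷ as) = cong (a ∷_) (closing-sources x (b ∷ as))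

  closing-targets : ∀ x a as → map proj₂ (closing x (a ∷ as)) ≡ as ++ [ x ]
  closing-targets x a []       = refl
  closing-targets x a (b ∷ as) = cong (b ∷_) (closing-targets x b as)

  steps-sources : ∀ c → map proj₁ (steps c) ≡ c
  steps-sources []       = refl
  steps-sources (a ∷ as) = closing-sources a (a ∷ as)

  steps-targets : ∀ c → map proj₂ (steps c) ↭ c
  steps-targets []       = ↭-refl
  steps-targets (a ∷ as) = ↭-trans (↭-reflexive (closing-targets a a as)) (↭-sym (∷↭∷ʳ a as))

  allSteps-sources : ∀ cs → map proj₁ (allSteps cs) ≡ concat cs
  allSteps-sources []       = refl
  allSteps-sources (c ∷ cs) =
    trans (map-++ proj₁ (steps c) _) (cong₂ _++_ (steps-sources c) (allSteps-sources cs))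

  allSteps-targets : ∀ cs → map proj₂ (allSteps cs) ↭ concat cs
  allSteps-targets []       = ↭-refl
  allSteps-targets (c ∷ cs) =
    ↭-trans (↭-reflexive (map-++ proj₂ (steps c) _)) (++⁺ (steps-targets c) (allSteps-targets cs))

-- A graph is given by the list of its vertices and edges.  The item `hang a` says that groups of
-- vertices may be attached at a, so that a may move by at most 3.
data Item (A : Set) : Set where
  node hang : A → Item A
  edge      : A → A → Item A

node? : ∀ {A} → Item A → Maybe A
node? (node a)   = just a
node? (hang _)   = nothing
node? (edge _ _) = nothing

nodes : ∀ {A} → List (Item A) → List A
nodes = mapMaybe node?

nodes-++ : ∀ {A} (I J : List (Item A)) → nodes (I ++ J) ≡ nodes I ++ nodes J
nodes-++ = mapMaybe-++ node?

nodes-edges : ∀ {A} (p : A) ts → nodes (map (edge p) ts) ≡ []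
nodes-edges p []       = refl
nodes-edges p (t ∷ ts) = nodes-edges p ts

IsEdge : ∀ {A} → List (Item A) → A → A → Set
IsEdge I a b = edge a b ∈ I ⊎ edge b a ∈ I

module Placement {A : Set} (Adj : A → A → Set) (adj-sym : ∀ {a b} → Adj a b → Adj b a) where

  Items : Set
  Items = List (Item A)

  -- Unlike exact distances, these bounds compose and pass through graph homomorphisms; shortest
  -- walks are needed only for the final statement.
  data Within : ℕ → A → A → Set where
    stay : ∀ {k u} → Within k u u
    step : ∀ {k u v w} → Adj u v → Within k v w → Within (suc k) u w

  within-≤ : ∀ {j k u v} → j ≤ k → Within j u v → Within k u v
  within-≤ _       stay       = stay
  within-≤ (s≤s l) (step e p) = step e (within-≤ l p)

  within-trans : ∀ {j k u v w} → Within j u v → Within k v w → Within (j + k) u w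
  within-trans {j} {k} stay q = within-≤ (ℕ.m≤n+m k j) q
  within-trans (step e p)   q = step e (within-trans p q)

  within-sym : ∀ {k u v} → Within k u v → Within k v u
  within-sym stay = stay
  within-sym {suc k} {u} {w} (step e p) =
    subst (λ j → Within j w u) (ℕ.+-comm k 1) (within-trans (within-sym p) (step {k = 0} (adj-sym e) stay))

  Edges : Items → Set
  Edges I = ∀ {a b} → edge a b ∈ I → Adj a b

  -- `apart` speaks of the edges of `I` only; the edges to other groups are dealt with when these
  -- are attached. `near` bounds every move by 4, as exchanging two leaves relies on it at a
  -- neighbour that carries no `hang`.
  record Placed (I : Items) (cs : List (List A)) : Set where
    field
      cover     : concat cs ↭ nodes I
      short     : All (λ c → length c ≤ 5) cs
      ends      : ∀ {a b} → edge a b ∈ I → a ∈ nodes I × b ∈ nodes I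
      hang-node : ∀ {u} → hang u ∈ I → u ∈ nodes I
      moves     : ∀ {u u′} → (u , u′) ∈ allSteps cs → u ≢ u′
      apart     : ∀ {a b a′ b′} → edge a b ∈ I → (a , a′) ∈ allSteps cs → (b , b′) ∈ allSteps cs →
                  ¬ IsEdge I a′ b′
      image     : ∀ {a b a′ b′} → edge a b ∈ I → (a , a′) ∈ allSteps cs → (b , b′) ∈ allSteps cs →
                  Within 6 a′ b′
      near      : ∀ {u u′} → (u , u′) ∈ allSteps cs → Within 4 u u′
      near-hang : ∀ {u u′} → hang u ∈ I → (u , u′) ∈ allSteps cs → Within 3 u u′

    source : ∀ {u u′} → (u , u′) ∈ allSteps cs → u ∈ nodes I
    source p = ∈-resp-↭ cover (subst (_ ∈_) (allSteps-sources cs) (∈-map⁺ proj₁ p))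

    target : ∀ {u u′} → (u , u′) ∈ allSteps cs → u′ ∈ nodes I
    target p = ∈-resp-↭ cover (∈-resp-↭ (allSteps-targets cs) (∈-map⁺ proj₂ p))

  record Rooted (r : A) (I : Items) (cs : List (List A)) : Set where
    field
      root∈     : r ∈ nodes I
      near-root : ∀ {r′} → (r , r′) ∈ allSteps cs → Within 2 r r′
      near-nbr  : ∀ {y y′} → IsEdge I r y → (y , y′) ∈ allSteps cs → Within 3 y y′

  -- Distances are those of the whole tree, whose adjacency is Adj.
  Good : A → Items → Set
  Good r I = Unique (nodes I) → Edges I → ∃[ cs ] Placed I cs × Rooted r I cs

  -- A group with tops ts, all of them adjacent to the vertex p outside it.
  Group : A → Items → List A → Set
  Group p I ts = Unique (p ∷ nodes I) → Edges (map (edge p) ts ++ I) →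
    ∃[ cs ] Placed I cs × (∀ {t} → t ∈ ts → t ∈ nodes I × (∀ {t′} → (t , t′) ∈ allSteps cs → Within 2 t t′))

  -- `far` is an assumption because it is met in two ways: by 3 + 1 + 2 if `p` carries `hang`, and
  -- by 4 + 1 if the images of the tops are adjacent to `p`.
  module _ {I I′ : Items} {cs cs′ : List (List A)} {p : A} {ts : List A}
           (P : Placed I cs) (P′ : Placed I′ cs′)
           (unique : Unique (nodes I ++ nodes I′)) (p∈ : p ∈ nodes I) (ts⊆ : ∀ {t} → t ∈ ts → t ∈ nodes I′)
           (far : ∀ {t p′ t′} → t ∈ ts → (p , p′) ∈ allSteps cs → (t , t′) ∈ allSteps cs′ → Within 6 p′ t′) where

    private
      module P  = Placed P
      module P′ = Placed P′
      Es = map (edge p) ts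
      K  = I ++ I′ ++ Es

      not-both : ∀ {a} → a ∈ nodes I → a ∉ nodes I′
      not-both a∈ a∈′ = proj₂ (proj₂ (++-unique⁻ (nodes I) unique)) (a∈ , a∈′)

      data Origin (i : Item A) : Set where
        old   : i ∈ I → Origin i
        new   : i ∈ I′ → Origin i
        cross : ∀ {t} → t ∈ ts → i ≡ edge p t → Origin i

      origin : ∀ {i} → i ∈ K → Origin i
      origin i∈ with ∈-++⁻ I i∈
      ... | inj₁ i∈I = old i∈I
      ... | inj₂ i∈r with ∈-++⁻ I′ i∈r
      ...   | inj₁ i∈I′ = new i∈I′
      ...   | inj₂ i∈E  with t , t∈ , eq ← ∈-map⁻ (edge p) i∈E = cross t∈ eq

      nodes-K : nodes K ≡ nodes I ++ nodes I′
      nodes-K = trans (nodes-++ I (I′ ++ Es)) (cong (nodes I ++_)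
        (trans (nodes-++ I′ Es) (trans (cong (nodes I′ ++_) (nodes-edges p ts)) (++-identityʳ (nodes I′)))))

      left : ∀ {a} → a ∈ nodes I → a ∈ nodes K
      left a∈ = subst (_ ∈_) (sym nodes-K) (∈-++⁺ˡ a∈)

      right : ∀ {a} → a ∈ nodes I′ → a ∈ nodes K
      right a∈ = subst (_ ∈_) (sym nodes-K) (∈-++⁺ʳ (nodes I) a∈)

      split : ∀ {u u′} → (u , u′) ∈ allSteps (cs ++ cs′) → (u , u′) ∈ allSteps cs ⊎ (u , u′) ∈ allSteps cs′
      split m = ∈-++⁻ (allSteps cs) (subst (_ ∈_) (concatMap-++ steps cs cs′) m)

      in-old : ∀ {u u′} → u ∈ nodes I → (u , u′) ∈ allSteps (cs ++ cs′) → (u , u′) ∈ allSteps cs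
      in-old u∈ m with split m
      ... | inj₁ m₁ = m₁
      ... | inj₂ m₂ = ⊥-elim (not-both u∈ (P′.source m₂))

      in-new : ∀ {u u′} → u ∈ nodes I′ → (u , u′) ∈ allSteps (cs ++ cs′) → (u , u′) ∈ allSteps cs′
      in-new u∈ m with split m
      ... | inj₁ m₁ = ⊥-elim (not-both (P.source m₁) u∈)
      ... | inj₂ m₂ = m₂

      apart-old : ∀ {a b} → a ∈ nodes I → b ∈ nodes I → edge a b ∈ K → edge a b ∈ I
      apart-old a∈ b∈ e with origin e
      ... | old e′ = e′
      ... | new e′ = ⊥-elim (not-both a∈ (proj₁ (P′.ends e′)))
      ... | cross t∈ refl = ⊥-elim (not-both b∈ (ts⊆ t∈))

      apart-new : ∀ {a b} → a ∈ nodes I′ → b ∈ nodes I′ → edge a b ∈ K → edge a b ∈ I′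
      apart-new a∈ b∈ e with origin e
      ... | old e′ = ⊥-elim (not-both (proj₁ (P.ends e′)) a∈)
      ... | new e′ = e′
      ... | cross t∈ refl = ⊥-elim (not-both p∈ a∈)

      -- All edges between the two parts meet p, and p is moved.
      apart-cross : ∀ {a b} → p ≢ a → a ∈ nodes I → b ∈ nodes I′ → ¬ IsEdge K a b
      apart-cross p≢a a∈ b∈ (inj₁ e) with origin e
      ... | old e′ = not-both (proj₂ (P.ends e′)) b∈
      ... | new e′ = not-both a∈ (proj₁ (P′.ends e′))
      ... | cross t∈ refl = p≢a refl
      apart-cross p≢a a∈ b∈ (inj₂ e) with origin e
      ... | old e′ = not-both (proj₁ (P.ends e′)) b∈
      ... | new e′ = not-both a∈ (proj₂ (P′.ends e′))
      ... | cross t∈ refl = not-both p∈ b∈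

    attach-placed : Placed K (cs ++ cs′)
    attach-placed = record
      { cover     = ↭-trans (↭-reflexive (sym (concat-++ cs cs′)))
                      (↭-trans (++⁺ P.cover P′.cover) (↭-reflexive (sym nodes-K)))
      ; short     = All.++⁺ P.short P′.short
      ; ends      = ends
      ; hang-node = hang-node
      ; moves     = λ m → Sum.[ P.moves , P′.moves ] (split m)
      ; apart     = apart
      ; image     = image
      ; near      = λ m → Sum.[ P.near , P′.near ] (split m)
      ; near-hang = near-hang
      }
      where
      ends : ∀ {a b} → edge a b ∈ K → a ∈ nodes K × b ∈ nodes K
      ends e with origin e
      ... | old e′ = let x , y = P.ends e′ in left x , left y
      ... | new e′ = let x , y = P′.ends e′ in right x , right y
      ... | cross t∈ refl = left p∈ , right (ts⊆ t∈)
      hang-node : ∀ {u} → hang u ∈ K → u ∈ nodes K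
      hang-node h with origin h
      ... | old h′ = left (P.hang-node h′)
      ... | new h′ = right (P′.hang-node h′)
      near-hang : ∀ {u u′} → hang u ∈ K → (u , u′) ∈ allSteps (cs ++ cs′) → Within 3 u u′
      near-hang h m with origin h
      ... | old h′ = P.near-hang h′ (in-old (P.hang-node h′) m)
      ... | new h′ = P′.near-hang h′ (in-new (P′.hang-node h′) m)
      apart : ∀ {a b a′ b′} → edge a b ∈ K → (a , a′) ∈ allSteps (cs ++ cs′) →
              (b , b′) ∈ allSteps (cs ++ cs′) → ¬ IsEdge K a′ b′
      apart e m n with origin e
      ... | old e′ = let x , y = P.ends e′ ; m′ = in-old x m ; n′ = in-old y n in
        P.apart e′ m′ n′ ∘ Sum.map (apart-old (P.target m′) (P.target n′)) (apart-old (P.target n′) (P.target m′))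
      ... | new e′ = let x , y = P′.ends e′ ; m′ = in-new x m ; n′ = in-new y n in
        P′.apart e′ m′ n′ ∘ Sum.map (apart-new (P′.target m′) (P′.target n′)) (apart-new (P′.target n′) (P′.target m′))
      ... | cross t∈ refl = let m′ = in-old p∈ m ; n′ = in-new (ts⊆ t∈) n in
        apart-cross (P.moves m′) (P.target m′) (P′.target n′)
      image : ∀ {a b a′ b′} → edge a b ∈ K → (a , a′) ∈ allSteps (cs ++ cs′) →
              (b , b′) ∈ allSteps (cs ++ cs′) → Within 6 a′ b′
      image e m n with origin e
      ... | old e′ = let x , y = P.ends e′ in P.image e′ (in-old x m) (in-old y n)
      ... | new e′ = let x , y = P′.ends e′ in P′.image e′ (in-new x m) (in-new y n)
      ... | cross t∈ refl = far t∈ (in-old p∈ m) (in-new (ts⊆ t∈) n)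

    -- The root gains neighbours only if it is `p` itself; these are tops, which `near-top` keeps
    -- within 3.
    attach-rooted : (∀ {t t′} → t ∈ ts → (t , t′) ∈ allSteps cs′ → Within 3 t t′) →
                    ∀ {r} → Rooted r I cs → Rooted r K (cs ++ cs′)
    attach-rooted near-top {r} R = record
      { root∈     = left R.root∈
      ; near-root = R.near-root ∘ in-old R.root∈
      ; near-nbr  = nbr
      }
      where
      module R = Rooted R
      nbr : ∀ {y y′} → IsEdge K r y → (y , y′) ∈ allSteps (cs ++ cs′) → Within 3 y y′
      nbr (inj₁ e) m with origin e
      ... | old e′ = R.near-nbr (inj₁ e′) (in-old (proj₂ (P.ends e′)) m)
      ... | new e′ = ⊥-elim (not-both R.root∈ (proj₁ (P′.ends e′)))
      ... | cross t∈ refl = near-top t∈ (in-new (ts⊆ t∈) m)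
      nbr (inj₂ e) m with origin e
      ... | old e′ = R.near-nbr (inj₂ e′) (in-old (proj₁ (P.ends e′)) m)
      ... | new e′ = ⊥-elim (not-both R.root∈ (proj₂ (P′.ends e′)))
      ... | cross t∈ refl = ⊥-elim (not-both R.root∈ (ts⊆ t∈))

-- Stars and small shapes

-- Stars with a distinguished vertex (`top`): `cen c ls` has centre and top c,
-- `tip a b l ls` has centre b and the leaf a as its top.
data Star (A : Set) : Set where
  cen : A → List A → Star A
  tip : A → A → A → List A → Star A

leafItems : ∀ {A} → A → List A → List (Item A)
leafItems b = concatMap (λ l → node l ∷ edge b l ∷ [])

module _ {A : Set} where

  top : Star A → A
  top (cen c _)     = c
  top (tip a _ _ _) = a

  verts : Star A → List A
  verts (cen c ls)     = c ∷ ls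
  verts (tip a b l ls) = a ∷ b ∷ l ∷ ls

  safe : Star A → List A
  safe (cen c ls)     = c ∷ ls
  safe (tip a b l ls) = a ∷ l ∷ ls

  plain : Star A → List (Item A)
  plain (cen c ls)     = node c ∷ leafItems c ls
  plain (tip a b l ls) = node a ∷ edge a b ∷ node b ∷ leafItems b (l ∷ ls)

  -- When two stars attached by leaves are placed together, a centre may have
  -- to move by 4, hence nothing may hang from it.
  open′ closed : Star A → List (Item A)
  open′  s = plain s ++ map hang (verts s)
  closed s = plain s ++ map hang (safe s)

  openBranch closedBranch : A → Star A → List (Item A)
  openBranch   v s = edge v (top s) ∷ open′ s
  closedBranch v s = edge v (top s) ∷ closed s

  coreItems : A → Star A → List (Star A) → List (Item A)
  coreItems v W Xs = node v ∷ hang v ∷ openBranch v W ++ concatMap (closedBranch v) Xs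

-- What remains of a star when the leaves after the first are removed in pairs: a single vertex
-- (`L`), or a star with one or two such leaves, attached by its centre (`C₁`, `C₂`) or by a further
-- leaf (`D₁`, `D₂`).
data Kind : Set where
  L C₁ C₂ D₁ D₂ : Kind

starAt : ∀ {A} → Kind → (ℕ → A) → Star A
starAt L  g = cen (g 0) []
starAt C₁ g = cen (g 0) (g 1 ∷ [])
starAt C₂ g = cen (g 0) (g 1 ∷ g 2 ∷ [])
starAt D₁ g = tip (g 0) (g 1) (g 2) []
starAt D₂ g = tip (g 0) (g 1) (g 2) (g 3 ∷ [])

-- Vertices at which the root may lie in a star: leaves after the first are interchangeable with it.
marks : Kind → List ℕ
marks L  = 0 ∷ []
marks C₁ = 0 ∷ 1 ∷ []
marks C₂ = 0 ∷ 1 ∷ []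
marks D₁ = 0 ∷ 1 ∷ 2 ∷ []
marks D₂ = 0 ∷ 1 ∷ 2 ∷ []

kinds bigKinds : List Kind
bigKinds = C₁ ∷ C₂ ∷ D₁ ∷ D₂ ∷ []
kinds    = L ∷ bigKinds

-- The vertex (j , i) is vertex i of branch j; the hub is (0 , 0).
Label : Set
Label = ℕ × ℕ

_≟_ : (u v : Label) → Dec (u ≡ v)
_≟_ = ≡-dec ℕ._≟_ ℕ._≟_

_==_ : Label → Label → Bool
(i , j) == (k , l) = (i ≡ᵇ k) ∧ (j ≡ᵇ l)

Shape : Set
Shape = List (Item Label)

isEdge-sym : ∀ {A} (I : List (Item A)) {a b} → IsEdge I a b → IsEdge I b a
isEdge-sym I = Sum.swap

-- Search for placements of small shapes

nbrs : (I : Shape) (u : Label) → List (Σ[ v ∈ Label ] IsEdge I u v)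
nbrs []             u = []
nbrs (node _ ∷ I)   u = map (λ (v , e) → v , Sum.map there there e) (nbrs I u)
nbrs (hang _ ∷ I)   u = map (λ (v , e) → v , Sum.map there there e) (nbrs I u)
nbrs (edge a b ∷ I) u = add (a ≟ u) (b ≟ u) (map (λ (v , e) → v , Sum.map there there e) (nbrs I u))
  where
  add : Dec (a ≡ u) → Dec (b ≡ u) → List _ → List _
  add (yes refl) _ vs          = (b , inj₁ (here refl)) ∷ vs
  add (no _)     (yes refl) vs = (a , inj₂ (here refl)) ∷ vs
  add (no _)     (no _)     vs = vs

_≟ᴵ_ : (i j : Item Label) → Dec (i ≡ j)
node a   ≟ᴵ node b   = map′ (cong node) (λ { refl → refl }) (a ≟ b)
node _   ≟ᴵ hang _   = no λ ()
node _   ≟ᴵ edge _ _ = no λ ()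
hang _   ≟ᴵ node _   = no λ ()
hang a   ≟ᴵ hang b   = map′ (cong hang) (λ { refl → refl }) (a ≟ b)
hang _   ≟ᴵ edge _ _ = no λ ()
edge _ _ ≟ᴵ node _   = no λ ()
edge _ _ ≟ᴵ hang _   = no λ ()
edge a b ≟ᴵ edge c d =
  map′ (λ (p , q) → cong₂ edge p q) (λ { refl → refl , refl }) ((a ≟ c) ×-dec (b ≟ d))

isEdge? : ∀ I (a b : Label) → Dec (IsEdge I a b)
isEdge? I a b = any? (edge a b ≟ᴵ_) I ⊎-dec any? (edge b a ≟ᴵ_) I

whenever : {P Q : Set} → Dec P → Maybe Q → Maybe (P → Q)
whenever (no ¬p) _ = just (⊥-elim ∘ ¬p)
whenever (yes _) q = q >>= λ q → just (λ _ → q)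

allMaybe : {A : Set} {P : A → Set} → (∀ a → Maybe (P a)) → ∀ as → Maybe (All P as)
allMaybe f []       = just []
allMaybe f (a ∷ as) = f a >>= λ p → allMaybe f as >>= λ ps → just (p ∷ ps)

permutation? : (us vs : List Label) → Maybe (us ↭ vs)
permutation? []       []      = just ↭-refl
permutation? []       (_ ∷ _) = nothing
permutation? (u ∷ us) vs      =
  remove vs >>= λ (vs′ , p) → permutation? us vs′ >>= λ q → just (↭-trans (prep u q) (↭-sym p))
  where
  remove : ∀ vs → Maybe (∃[ vs′ ] vs ↭ u ∷ vs′)
  remove []       = nothing
  remove (v ∷ vs) with v ≟ u
  ... | yes refl = just (vs , ↭-refl)
  ... | no _     = remove vs >>= λ (vs′ , p) → just (v ∷ vs′ , ↭-trans (prep v p) (swap v u ↭-refl))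

-- A placement of I is searched for; distances are taken in M.
module Search (I M : Shape) where
  open Placement (IsEdge M) (isEdge-sym M)

  neighbours : Label → Shape → List Label
  neighbours u []             = []
  neighbours u (node _ ∷ J)   = neighbours u J
  neighbours u (hang _ ∷ J)   = neighbours u J
  neighbours u (edge a b ∷ J) =
    if a == u then b ∷ neighbours u J else if b == u then a ∷ neighbours u J else neighbours u J

  ball  : ℕ → Label → Label → List Label
  balls : ℕ → Label → Label → List Label → List Label
  ball zero    w u = [ u ]
  ball (suc k) w u = u ∷ balls k w u (neighbours u M)
  balls k w u []       = []
  balls k w u (v ∷ vs) = if v == w then balls k w u vs else ball k u v ++ balls k w u vs

  parent-of : Label → Shape → Maybe Label
  parent-of u (edge a b ∷ J) = if u == b then just a else parent-of u J
  parent-of u (node _ ∷ J)   = parent-of u J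
  parent-of u (hang _ ∷ J)   = parent-of u J
  parent-of u []             = nothing

  -- A vertex with its neighbours.
  Spot : Set
  Spot = Label × List Label

  -- A vertex with its parent and its admissible images.
  Task : Set
  Task = Label × Maybe Label × List Spot

  image-of : Label → List (Label × Spot) → Maybe Spot
  image-of u []              = nothing
  image-of u ((v , v′) ∷ ms) = if u == v then just v′ else image-of u ms

  free : Label → List (Label × Spot) → Bool
  free w []                  = true
  free w ((_ , w′ , _) ∷ ms) = if w == w′ then false else free w ms

  compatible : Maybe Label → Label → List (Label × Spot) → Bool
  compatible nothing  w ms = free w ms
  compatible (just p) w ms =
    -- Shapes list a vertex after its parent, so the image of `p` is known by now. The default
    -- `true` is harmless in any case, as `placed?` checks the outcome.
    free w ms ∧ maybe′ (λ (_ , ns) → not (any (w ==_) ns)) true (image-of p ms)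

  cycle-from : Label → ℕ → Label → List (Label × Spot) → Maybe (List Label)
  cycle-from s zero    u ms = nothing
  cycle-from s (suc k) u ms = image-of u ms >>= λ (u′ , _) →
    if u′ == s then just [ u ] else (cycle-from s k u′ ms >>= λ c → just (u ∷ c))

  cycles : List (Label × Spot) → List (Label × Spot) → List Label → Maybe (List (List Label))
  cycles []             ms seen = just []
  cycles ((u , _) ∷ us) ms seen = if any (u ==_) seen then cycles us ms seen else
    -- The fuel 5 is the bound on the length of cycles.
    (cycle-from u 5 u ms >>= λ c → cycles us ms (c ++ seen) >>= λ cs → just (c ∷ cs))

  -- Backtracking; nothing is proved about it, since `placed?` verifies the cycles that it returns.
  -- Their lengths are tested only for complete assignments.
  assign : List Task → List (Label × Spot) → Maybe (List (List Label))
  try    : Label → Maybe Label → List Spot → List Task → List (Label × Spot) → Maybe (List (List Label))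
  assign []                   ms = cycles ms ms []
  assign ((u , p , ws) ∷ uws) ms = try u p ws uws ms
  try u p []       uws ms = nothing
  try u p (w ∷ ws) uws ms =
    if compatible p (proj₁ w) ms then maybe′ just (try u p ws uws ms) (assign uws ((u , w) ∷ ms)) else try u p ws uws ms

  tasks : (Label → ℕ) → List Spot → List Task
  -- Taking `u` as the vertex just left excludes nothing, as `u` is not its own neighbour.
  tasks limit spots = map (λ (u , _) → u , parent-of u I , task u (ball (limit u) u u)) spots
    where
    task : Label → List Label → List Spot
    task u ws = filterᵇ (λ (w , _) → not (u == w) ∧ any (w ==_) ws) spots

  search : (Label → ℕ) → Maybe (List (List Label))
  search limit = assign (tasks limit (map (λ u → u , neighbours u I) (nodes I))) []

  -- The second argument is the vertex just left, which a shortest path does not visit again.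
  within?  : ∀ k → Label → (u v : Label) → Maybe (Within k u v)
  through? : ∀ k → Label → ∀ {u} → List (Σ[ v ∈ Label ] IsEdge M u v) → ∀ w → Maybe (Within (suc k) u w)
  within? k x u v with u ≟ v
  within? k       x u v | yes refl = just stay
  within? zero    x u v | no _     = nothing
  within? (suc k) x u v | no _     = through? k x (nbrs M u) v
  through? k x []             w = nothing
  through? k x {u} ((v , e) ∷ ns) w =
    if v == x then through? k x ns w
    else maybe′ (λ p → just (step e p)) (through? k x ns w) (within? k u v w)

  hub : Label
  hub = 0 , 0

  module _ (cs : List (List Label)) where

    S : List (Label × Label)
    S = allSteps cs

    moves-within? : ∀ k u → Maybe (∀ {u′} → (u , u′) ∈ S → Within k u u′)
    moves-within? k u =
      allMaybe (λ (v , v′) → whenever (v ≟ u) (within? k v v v′)) S >>= λ ok →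
      just (λ m → All.lookup ok m refl)

    ItemOK : Item Label → Set
    ItemOK (node _)   = ⊤
    ItemOK (hang u)   = u ∈ nodes I × (∀ {u′} → (u , u′) ∈ S → Within 3 u u′)
    ItemOK (edge a b) = (a ∈ nodes I × b ∈ nodes I) ×
      (∀ {a′ b′} → (a , a′) ∈ S → (b , b′) ∈ S → ¬ IsEdge I a′ b′)

    itemOK? : ∀ i → Maybe (ItemOK i)
    itemOK? (node _) = just tt
    itemOK? (hang u) =
      dec⇒maybe (any? (u ≟_) (nodes I)) >>= λ u∈ → moves-within? 3 u >>= λ n → just (u∈ , n)
    itemOK? (edge a b) =
      dec⇒maybe (any? (a ≟_) (nodes I) ×-dec any? (b ≟_) (nodes I)) >>= λ ends →
      allMaybe (λ (u , a′) → whenever (u ≟ a)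
        (allMaybe (λ (w , b′) → whenever (w ≟ b) (dec⇒maybe (¬? (isEdge? I a′ b′)))) S)) S >>= λ ok →
      just (ends , λ m n → All.lookup (All.lookup ok m refl) n refl)

    placed? : Maybe (Placed I cs)
    placed? =
      permutation? (concat cs) (nodes I) >>= λ cover →
      allMaybe (λ c → dec⇒maybe (length c ℕ.≤? 5)) cs >>= λ short →
      allMaybe itemOK? I >>= λ items →
      allMaybe (λ (u , u′) → dec⇒maybe (¬? (u ≟ u′)) >>= λ p → within? 4 u u u′ >>= λ q → just (p , q)) S
        >>= λ nears →
      -- All vertices are within distance 3 of the hub, which bounds all distances by 6.
      allMaybe (within? 3 hub hub) (nodes I) >>= λ depth →
      let target = λ {u u′} (m : (u , u′) ∈ S) → ∈-resp-↭ cover (∈-resp-↭ (allSteps-targets cs) (∈-map⁺ proj₂ m)) in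
      just record
        { cover     = cover
        ; short     = short
        ; ends      = proj₁ ∘ All.lookup items
        ; hang-node = proj₁ ∘ All.lookup items
        ; moves     = proj₁ ∘ All.lookup nears
        ; apart     = λ e m n → proj₂ (All.lookup items e) m n
        ; image     = λ _ m n → within-trans (within-sym (All.lookup depth (target m))) (All.lookup depth (target n))
        ; near      = proj₂ ∘ All.lookup nears
        ; near-hang = λ h m → proj₂ (All.lookup items h) m
        }

    rooted? : ∀ r → Maybe (Rooted r I cs)
    rooted? r =
      dec⇒maybe (any? (r ≟_) (nodes I)) >>= λ root∈ →
      moves-within? 2 r >>= λ near-root →
      allMaybe nbr? I >>= λ nbrs →
      just record
        { root∈     = root∈
        ; near-root = near-root
        ; near-nbr  = Sum.[ (λ e → proj₁ (All.lookup nbrs e) refl) , (λ e → proj₂ (All.lookup nbrs e) refl) ]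
        }
      where
      Near : Label → Set
      Near y = ∀ {y′} → (y , y′) ∈ S → Within 3 y y′
      NbrOK : Item Label → Set
      NbrOK (edge a b) = (a ≡ r → Near b) × (b ≡ r → Near a)
      NbrOK _          = ⊤
      nbr? : ∀ i → Maybe (NbrOK i)
      nbr? (node _)   = just tt
      nbr? (hang _)   = just tt
      nbr? (edge a b) = whenever (a ≟ r) (moves-within? 3 b) >>= λ p →
        whenever (b ≟ r) (moves-within? 3 a) >>= λ q → just ((λ { refl → p refl }) , (λ { refl → q refl }))

    tops? : ∀ ts → Maybe (All (λ t → t ∈ nodes I × (∀ {t′} → (t , t′) ∈ S → Within 2 t t′)) ts)
    tops? = allMaybe λ t →
      dec⇒maybe (any? (t ≟_) (nodes I)) >>= λ t∈ → moves-within? 2 t >>= λ near → just (t∈ , near)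

  hanging : Label → Bool
  hanging u = any (λ { (hang v) → u == v ; _ → false }) I

  -- In the shapes searched with a root, all neighbours of the root carry `hang`, so the bound 3
  -- covers the condition on them too.
  limit : List Label → Label → ℕ
  limit ts u = if any (u ==_) ts then 2 else if hanging u then 3 else 4

-- Tables of placed shapes

RootedShape : Shape → Label → Set
RootedShape I r = ∃[ cs ] Placed I cs × Rooted r I cs
  where open Placement (IsEdge I) (isEdge-sym I)

rootedShape? : ∀ I r → Maybe (RootedShape I r)
rootedShape? I r = search (limit [ r ]) >>= λ cs → placed? cs >>= λ P → rooted? cs r >>= λ R → just (cs , P , R)
  where open Search I I

-- Most shapes have one placement that suits all roots.
rootedShapes? : ∀ I rs → Maybe (All (RootedShape I) rs)
rootedShapes? I rs = maybe′ just (allMaybe (rootedShape? I) rs)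
  (search (limit rs) >>= λ cs → placed? cs >>= λ P → allMaybe (λ r → rooted? cs r >>= λ R → just (cs , P , R)) rs)
  where open Search I I

-- `p` is not moved with the group, but distances may pass through it: it is what joins the tops.
GroupShape : Label → Shape → List Label → Set
GroupShape p I ts =
  ∃[ cs ] Placed I cs × All (λ t → t ∈ nodes I × (∀ {t′} → (t , t′) ∈ allSteps cs → Within 2 t t′)) ts
  where open Placement (IsEdge (map (edge p) ts ++ I)) (isEdge-sym (map (edge p) ts ++ I))

groupShape? : ∀ p I ts → Maybe (GroupShape p I ts)
groupShape? p I ts = search (limit ts) >>= λ cs → placed? cs >>= λ P → tops? cs ts >>= λ R → just (cs , P , R)
  where open Search I (map (edge p) ts ++ I)

mainItems : ∀ {A} → A → Star A → Star A → List (Star A) → List (Item A)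
mainItems v S W Ys =
  node v ∷ hang v ∷ openBranch v S ++ openBranch v W ++ concatMap (closedBranch v) Ys

pairItems : ∀ {A} → Star A → Star A → List (Item A)
pairItems X Y = closed X ++ closed Y

mainShape : Kind → Kind → List Kind → Shape
mainShape k l ks = mainItems (0 , 0) (starAt k (1 ,_)) (starAt l (2 ,_)) (map (λ m → starAt m (3 ,_)) ks)

mainRoots : Kind → List Label
mainRoots k = (0 , 0) ∷ map (1 ,_) (marks k)

loneShape : Kind → Shape
loneShape k = coreItems (0 , 0) (starAt k (1 ,_)) []

pairShape : Kind → Kind → Shape
pairShape k l = pairItems (starAt k (1 ,_)) (starAt l (2 ,_))

tails : List (List Kind)
tails = [] ∷ map [_] kinds

-- The type checker runs the search: `tt` is accepted only if `m` evaluates to a result.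
witness : {P : Set} (m : Maybe P) → T (is-just m) → P
witness (just p) _ = p

-- Later proofs must not unfold the search.
abstract
  main-table : All (λ k → All (λ l → All (λ ks → All (RootedShape (mainShape k l ks)) (mainRoots k)) tails) bigKinds) kinds
  main-table = witness (allMaybe (λ k → allMaybe (λ l → allMaybe (λ ks →
    rootedShapes? (mainShape k l ks) (mainRoots k)) tails) bigKinds) kinds) tt

  lone-table : All (λ k → RootedShape (loneShape k) (0 , 0)) (D₁ ∷ D₂ ∷ [])
  lone-table = witness (allMaybe (λ k → rootedShape? (loneShape k) (0 , 0)) (D₁ ∷ D₂ ∷ [])) tt

  pair-table : All (λ k → All (λ l → GroupShape (0 , 0) (pairShape k l) ((1 , 0) ∷ (2 , 0) ∷ [])) kinds) kinds
  pair-table = witness (allMaybe (λ k → allMaybe (λ l →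
    groupShape? (0 , 0) (pairShape k l) ((1 , 0) ∷ (2 , 0) ∷ [])) kinds) kinds) tt

-- Relabelling

mapItem : {A B : Set} → (A → B) → Item A → Item B
mapItem f (node a)   = node (f a)
mapItem f (hang a)   = hang (f a)
mapItem f (edge a b) = edge (f a) (f b)

nodes-map : {A B : Set} (f : A → B) (I : List (Item A)) → nodes (map (mapItem f) I) ≡ map f (nodes I)
nodes-map f []             = refl
nodes-map f (node a ∷ I)   = cong (f a ∷_) (nodes-map f I)
nodes-map f (hang _ ∷ I)   = nodes-map f I
nodes-map f (edge _ _ ∷ I) = nodes-map f I

closing-map : {A B : Set} (f : A → B) (x : A) (as : List A) →
              closing (f x) (map f as) ≡ map (λ (u , v) → f u , f v) (closing x as)
closing-map f x []           = refl
closing-map f x (a ∷ [])     = refl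
closing-map f x (a ∷ b ∷ as) = cong ((f a , f b) ∷_) (closing-map f x (b ∷ as))

allSteps-map : {A B : Set} (f : A → B) (cs : List (List A)) →
               allSteps (map (map f) cs) ≡ map (λ (u , v) → f u , f v) (allSteps cs)
allSteps-map f []              = refl
allSteps-map f ([] ∷ cs)       = allSteps-map f cs
allSteps-map f ((a ∷ as) ∷ cs) =
  trans (cong₂ _++_ (closing-map f a (a ∷ as)) (allSteps-map f cs)) (sym (map-++ _ (closing a (a ∷ as)) (allSteps cs)))

injective-on : {A B : Set} (f : A → B) {as : List A} → Unique (map f as) →
               ∀ {a b} → a ∈ as → b ∈ as → f a ≡ f b → a ≡ b
injective-on f (_ ∷ _) (here refl) (here refl) _ = refl
injective-on f (p ∷ _) (here refl) (there b∈)  e = ⊥-elim (All.lookup p (∈-map⁺ f b∈) e)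
injective-on f (p ∷ _) (there a∈)  (here refl) e = ⊥-elim (All.lookup p (∈-map⁺ f a∈) (sym e))
injective-on f (_ ∷ u) (there a∈)  (there b∈)  e = injective-on f u a∈ b∈ e

-- A homomorphism maps walks to walks, so bounds on distances survive. Edges must also be reflected
-- for `apart`; this only takes injectivity on the vertices of `I`, which follows from the
-- uniqueness of their images.
module Relabel {A B : Set} (AdjA : A → A → Set) (symA : ∀ {a b} → AdjA a b → AdjA b a)
               (AdjB : B → B → Set) (symB : ∀ {a b} → AdjB a b → AdjB b a)
               (f : A → B) (hom : ∀ {a b} → AdjA a b → AdjB (f a) (f b)) where

  private
    module A = Placement AdjA symA
    module B = Placement AdjB symB

  within : ∀ {k u v} → A.Within k u v → B.Within k (f u) (f v)
  within A.stay       = B.stay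
  within (A.step e p) = B.step (hom e) (within p)

  module _ {I : List (Item A)} {cs : List (List A)} (P : A.Placed I cs)
           (unique : Unique (nodes (map (mapItem f) I))) where
    private
      module P = A.Placed P
      I′  = map (mapItem f) I
      cs′ = map (map f) cs

    inj : ∀ {a b} → a ∈ nodes I → b ∈ nodes I → f a ≡ f b → a ≡ b
    inj = injective-on f (subst Unique (nodes-map f I) unique)

    data Image (u u′ : B) : Set where
      image : ∀ {v v′} → (v , v′) ∈ allSteps cs → u ≡ f v → u′ ≡ f v′ → Image u u′

    pre : ∀ {u u′} → (u , u′) ∈ allSteps cs′ → Image u u′
    pre m with (_ , _) , m′ , refl ← ∈-map⁻ _ (subst (_ ∈_) (allSteps-map f cs) m) = image m′ refl refl

    pre-at : ∀ {v u′} → v ∈ nodes I → (f v , u′) ∈ allSteps cs′ → ∃[ v′ ] (v , v′) ∈ allSteps cs × u′ ≡ f v′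
    pre-at v∈ m with image m′ p refl ← pre m with refl ← inj v∈ (P.source m′) p = _ , m′ , refl

    pre-edge : ∀ {a b} → edge a b ∈ I′ → ∃[ c ] ∃[ d ] edge c d ∈ I × a ≡ f c × b ≡ f d
    pre-edge e with edge c d , e′ , refl ← ∈-map⁻ (mapItem f) e = c , d , e′ , refl , refl

    pre-hang : ∀ {a} → hang a ∈ I′ → ∃[ c ] hang c ∈ I × a ≡ f c
    pre-hang h with hang c , h′ , refl ← ∈-map⁻ (mapItem f) h = c , h′ , refl

    post : ∀ {a} → a ∈ nodes I → f a ∈ nodes I′
    post a∈ = subst (_ ∈_) (sym (nodes-map f I)) (∈-map⁺ f a∈)

    pre-isEdge : ∀ {a b} → a ∈ nodes I → b ∈ nodes I → IsEdge I′ (f a) (f b) → IsEdge I a b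
    pre-isEdge a∈ b∈ (inj₁ e) with c , d , e′ , p , q ← pre-edge e
      with refl ← inj a∈ (proj₁ (P.ends e′)) p | refl ← inj b∈ (proj₂ (P.ends e′)) q = inj₁ e′
    pre-isEdge a∈ b∈ (inj₂ e) with c , d , e′ , p , q ← pre-edge e
      with refl ← inj b∈ (proj₁ (P.ends e′)) p | refl ← inj a∈ (proj₂ (P.ends e′)) q = inj₂ e′

    placed : B.Placed I′ cs′
    placed = record
      { cover     = ↭-trans (↭-reflexive (concat-map cs))
                      (↭-trans (↭-map⁺ f P.cover) (↭-reflexive (sym (nodes-map f I))))
      ; short     = All.map⁺ (All.map (λ {c} le → subst (_≤ 5) (sym (length-map f c)) le) P.short)
      ; ends      = ends
      ; hang-node = hang-node
      ; moves     = moves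
      ; apart     = apart
      ; image     = image-within
      ; near      = near
      ; near-hang = near-hang
      }
      where
      ends : ∀ {a b} → edge a b ∈ I′ → a ∈ nodes I′ × b ∈ nodes I′
      ends e with c , d , e′ , refl , refl ← pre-edge e = let x , y = P.ends e′ in post x , post y
      hang-node : ∀ {u} → hang u ∈ I′ → u ∈ nodes I′
      hang-node h with c , h′ , refl ← pre-hang h = post (P.hang-node h′)
      moves : ∀ {u u′} → (u , u′) ∈ allSteps cs′ → u ≢ u′
      moves m eq with image m′ refl refl ← pre m = P.moves m′ (inj (P.source m′) (P.target m′) eq)
      apart : ∀ {a b a′ b′} → edge a b ∈ I′ → (a , a′) ∈ allSteps cs′ → (b , b′) ∈ allSteps cs′ → ¬ IsEdge I′ a′ b′
      apart e m n i with c , d , e′ , refl , refl ← pre-edge e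
        with a′ , m′ , refl ← pre-at (proj₁ (P.ends e′)) m | b′ , n′ , refl ← pre-at (proj₂ (P.ends e′)) n =
        P.apart e′ m′ n′ (pre-isEdge (P.target m′) (P.target n′) i)
      image-within : ∀ {a b a′ b′} → edge a b ∈ I′ → (a , a′) ∈ allSteps cs′ → (b , b′) ∈ allSteps cs′ →
                     B.Within 6 a′ b′
      image-within e m n with c , d , e′ , refl , refl ← pre-edge e
        with a′ , m′ , refl ← pre-at (proj₁ (P.ends e′)) m | b′ , n′ , refl ← pre-at (proj₂ (P.ends e′)) n =
        within (P.image e′ m′ n′)
      near : ∀ {u u′} → (u , u′) ∈ allSteps cs′ → B.Within 4 u u′
      near m with image m′ refl refl ← pre m = within (P.near m′)
      near-hang : ∀ {u u′} → hang u ∈ I′ → (u , u′) ∈ allSteps cs′ → B.Within 3 u u′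
      near-hang h m with c , h′ , refl ← pre-hang h with a′ , m′ , refl ← pre-at (P.hang-node h′) m =
        within (P.near-hang h′ m′)

    rooted : ∀ {r} → A.Rooted r I cs → B.Rooted (f r) I′ cs′
    rooted {r} R = record { root∈ = post R.root∈ ; near-root = near-root ; near-nbr = near-nbr }
      where
      module R = A.Rooted R
      near-root : ∀ {r′} → (f r , r′) ∈ allSteps cs′ → B.Within 2 (f r) r′
      near-root m with a′ , m′ , refl ← pre-at R.root∈ m = within (R.near-root m′)
      near-nbr : ∀ {y y′} → IsEdge I′ (f r) y → (y , y′) ∈ allSteps cs′ → B.Within 3 y y′
      near-nbr i m with image {v = v} m′ refl refl ← pre m =
        within (R.near-nbr (pre-isEdge R.root∈ (P.source m′) i) m′)

    top-near : ∀ {t} → t ∈ nodes I → (∀ {t′} → (t , t′) ∈ allSteps cs → A.Within 2 t t′) →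
               ∀ {t′} → (f t , t′) ∈ allSteps cs′ → B.Within 2 (f t) t′
    top-near t∈ near m with a′ , m′ , refl ← pre-at t∈ m = within (near m′)

-- Reduction of trees to small shapes

module Reduction {A : Set} (Adj : A → A → Set) (adj-sym : ∀ {a b} → Adj a b → Adj b a) where
  open Placement Adj adj-sym
  open import Algebra.Solver.CommutativeMonoid (++-commutativeMonoid {A = Item A})
    using (solve; _⊕_; _⊜_) renaming (id to ε)

  -- The same graph up to the order of items and the orientation of edges, where `I′` may have made
  -- fewer promises `hang`.
  record _≼_ (I I′ : Items) : Set where
    field
      same-nodes : nodes I ↭ nodes I′
      edge-to    : ∀ {a b} → edge a b ∈ I → IsEdge I′ a b
      edge-from  : ∀ {a b} → edge a b ∈ I′ → IsEdge I a b
      hang-from  : ∀ {a} → hang a ∈ I′ → hang a ∈ I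

  good-≼ : ∀ {I I′ r} → I ≼ I′ → Good r I → Good r I′
  good-≼ {I} {I′} {r} le good unique edges =
    let cs , P , R = good (unique-resp-↭ (↭-sym same-nodes) unique) (λ e → adj (edge-to e)) in
    cs , placed P , rooted R
    where
    open _≼_ le
    adj : ∀ {a b} → IsEdge I′ a b → Adj a b
    adj (inj₁ e) = edges e
    adj (inj₂ e) = adj-sym (edges e)
    to : ∀ {a b} → IsEdge I a b → IsEdge I′ a b
    to (inj₁ e) = edge-to e
    to (inj₂ e) = Sum.swap (edge-to e)
    from : ∀ {a b} → IsEdge I′ a b → IsEdge I a b
    from (inj₁ e) = edge-from e
    from (inj₂ e) = Sum.swap (edge-from e)
    module _ {cs : List (List A)} where
      placed : Placed I cs → Placed I′ cs
      placed P = record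
        { cover     = ↭-trans cover same-nodes
        ; short     = short
        ; ends      = ends′ ∘ edge-from
        ; hang-node = ∈-resp-↭ same-nodes ∘ hang-node ∘ hang-from
        ; moves     = moves
        ; apart     = λ e m n → apart′ (edge-from e) m n ∘ from
        ; image     = λ e → image′ (edge-from e)
        ; near      = near
        ; near-hang = near-hang ∘ hang-from
        }
        where
        open Placed P
        ends′ : ∀ {a b} → IsEdge I a b → a ∈ nodes I′ × b ∈ nodes I′
        ends′ (inj₁ e) = let x , y = ends e in ∈-resp-↭ same-nodes x , ∈-resp-↭ same-nodes y
        ends′ (inj₂ e) = let x , y = ends e in ∈-resp-↭ same-nodes y , ∈-resp-↭ same-nodes x
        apart′ : ∀ {a b a′ b′} → IsEdge I a b → (a , a′) ∈ allSteps cs → (b , b′) ∈ allSteps cs → ¬ IsEdge I a′ b′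
        apart′ (inj₁ e) m n = apart e m n
        apart′ (inj₂ e) m n = apart e n m ∘ Sum.swap
        image′ : ∀ {a b a′ b′} → IsEdge I a b → (a , a′) ∈ allSteps cs → (b , b′) ∈ allSteps cs → Within 6 a′ b′
        image′ (inj₁ e) m n = image e m n
        image′ (inj₂ e) m n = within-sym (image e n m)
      rooted : Rooted r I cs → Rooted r I′ cs
      rooted R = record
        { root∈     = ∈-resp-↭ same-nodes root∈
        ; near-root = near-root
        ; near-nbr  = near-nbr ∘ from
        }
        where open Rooted R

  ↭⇒≼ : ∀ {I I′} → I ↭ I′ → I ≼ I′
  ↭⇒≼ p = record
    { same-nodes = mapMaybe-↭ node? p
    ; edge-to    = inj₁ ∘ ∈-resp-↭ p
    ; edge-from  = inj₁ ∘ ∈-resp-↭ (↭-sym p)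
    ; hang-from  = ∈-resp-↭ (↭-sym p)
    }

  ≼-++ : ∀ J {I I′} → I ≼ I′ → (J ++ I) ≼ (J ++ I′)
  ≼-++ J {I} {I′} le = record
    { same-nodes = ↭-trans (↭-reflexive (nodes-++ J I))
                     (↭-trans (++⁺ˡ (nodes J) same-nodes) (↭-reflexive (sym (nodes-++ J I′))))
    ; edge-to    = ctx edge-to
    ; edge-from  = ctx edge-from
    ; hang-from  = λ h → Sum.[ ∈-++⁺ˡ , ∈-++⁺ʳ J ∘ hang-from ] (∈-++⁻ J h)
    }
    where
    open _≼_ le
    ctx : ∀ {K L a b} → (edge a b ∈ K → IsEdge L a b) → edge a b ∈ J ++ K → IsEdge (J ++ L) a b
    ctx f e with ∈-++⁻ J e
    ... | inj₁ e₁ = inj₁ (∈-++⁺ˡ e₁)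
    ... | inj₂ e₂ = Sum.map (∈-++⁺ʳ J) (∈-++⁺ʳ J) (f e₂)

  infix 3 _⊑_
  -- Quantifying over the context `J` makes this a congruence for `++`, so that a part of a tree can
  -- be reduced in place. Typically `I` is the reduced graph and `I′` the full one.
  record _⊑_ (I I′ : Items) : Set where
    constructor extend
    field within : ∀ {r} J → Good r (J ++ I) → Good r (J ++ I′)
  open _⊑_

  good-⊑ : ∀ {I I′ r} → I ⊑ I′ → Good r I → Good r I′
  good-⊑ le = within le []

  ≼⇒⊑ : ∀ {I I′} → I ≼ I′ → I ⊑ I′
  ≼⇒⊑ le = extend λ J → good-≼ (≼-++ J le)

  ↭⇒⊑ : ∀ {I I′} → I ↭ I′ → I ⊑ I′
  ↭⇒⊑ = ≼⇒⊑ ∘ ↭⇒≼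

  ⊑-refl : ∀ {I} → I ⊑ I
  ⊑-refl = extend λ _ → id

  infixr 4 _⨾_
  _⨾_ : ∀ {I J K} → I ⊑ J → J ⊑ K → I ⊑ K
  p ⨾ q = extend λ J → within q J ∘ within p J

  ⊑-++ˡ : ∀ K {I I′} → I ⊑ I′ → K ++ I ⊑ K ++ I′
  ⊑-++ˡ K {I} {I′} le = extend λ J g →
    subst (Good _) (++-assoc J K I′) (within le (J ++ K) (subst (Good _) (sym (++-assoc J K I)) g))

  ⊑-++ʳ : ∀ K {I I′} → I ⊑ I′ → I ++ K ⊑ I′ ++ K
  ⊑-++ʳ K {I} {I′} le = ↭⇒⊑ (++-comm I K) ⨾ ⊑-++ˡ K le ⨾ ↭⇒⊑ (++-comm K I′)

  ⊑-++ : ∀ {I I′ K K′} → I ⊑ I′ → K ⊑ K′ → I ++ K ⊑ I′ ++ K′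
  ⊑-++ {I′ = I′} {K = K} p q = ⊑-++ʳ K p ⨾ ⊑-++ˡ I′ q

  unhang : ∀ as → map hang as ⊑ []
  unhang as = ≼⇒⊑ record
    { same-nodes = ↭-reflexive (none as)
    ; edge-to    = λ e → no-edge as e
    ; edge-from  = λ ()
    ; hang-from  = λ ()
    }
    where
    none : ∀ as → nodes {A} (map hang as) ≡ []
    none []       = refl
    none (_ ∷ as) = none as
    no-edge : ∀ as {a b} → edge a b ∈ map hang as → IsEdge [] a b
    no-edge (_ ∷ as) (there e) = no-edge as e

  flip : ∀ {a b} → [ edge a b ] ⊑ [ edge b a ]
  flip = ≼⇒⊑ record
    { same-nodes = ↭-refl
    ; edge-to    = λ { (here refl) → inj₂ (here refl) }
    ; edge-from  = λ { (here refl) → inj₂ (here refl) }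
    ; hang-from  = λ { (here ()) ; (there ()) }
    }

  private
    module Attach {p : A} {I K : Items} {ts : List A} (unique : Unique (nodes (I ++ K ++ map (edge p) ts)))
                  (edges : Edges (I ++ K ++ map (edge p) ts)) where
      Es = map (edge p) ts

      nodes-all : nodes (I ++ K ++ Es) ≡ nodes I ++ nodes K
      nodes-all = trans (nodes-++ I (K ++ Es)) (cong (nodes I ++_)
        (trans (nodes-++ K Es) (trans (cong (nodes K ++_) (nodes-edges p ts)) (++-identityʳ (nodes K)))))

      unique′ : Unique (nodes I ++ nodes K)
      unique′ = subst Unique nodes-all unique

      edges-I : Edges I
      edges-I = edges ∘ ∈-++⁺ˡ

      adj : ∀ {t} → t ∈ ts → Adj p t
      adj t∈ = edges (∈-++⁺ʳ I (∈-++⁺ʳ K (∈-map⁺ (edge p) t∈)))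

      edges-K : Edges (Es ++ K)
      edges-K e with ∈-++⁻ Es e
      ... | inj₁ e₁ = edges (∈-++⁺ʳ I (∈-++⁺ʳ K e₁))
      ... | inj₂ e₂ = edges (∈-++⁺ʳ I (∈-++⁺ˡ e₂))

      unique-I : Unique (nodes I)
      unique-I = proj₁ (++-unique⁻ (nodes I) unique′)

      unique-K : p ∈ nodes I → Unique (p ∷ nodes K)
      unique-K p∈ = let _ , u , d = ++-unique⁻ (nodes I) unique′ in
        All.tabulate (λ x∈ p≡x → d (p∈ , subst (_∈ nodes K) (sym p≡x) x∈)) ∷ u

  attach : ∀ {r p I K ts} → hang p ∈ I → Group p K ts → Good r I → Good r (I ++ K ++ map (edge p) ts)
  attach {r} {p} {I} {K} {ts} h group good unique edges =
    let cs , P , R = good unique-I edges-I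
        p∈ = Placed.hang-node P h
        cs′ , P′ , tops = group (unique-K p∈) edges-K
        near-top = λ {t} {t′} (t∈ : t ∈ ts) m → proj₂ (tops t∈) {t′} m
    in cs ++ cs′ ,
       attach-placed P P′ unique′ p∈ (proj₁ ∘ tops)
         (λ t∈ m n → within-trans (within-sym (Placed.near-hang P h m)) (step (adj t∈) (near-top t∈ n))) ,
       attach-rooted P P′ unique′ p∈ (proj₁ ∘ tops)
         (λ t∈ m n → within-trans (within-sym (Placed.near-hang P h m)) (step (adj t∈) (near-top t∈ n)))
         (λ t∈ n → within-≤ (s≤s (s≤s z≤n)) (near-top t∈ n)) R
    where open Attach {p} {I} {K} {ts} unique edges

  hang-group : ∀ {p I K ts} → hang p ∈ I → Group p K ts → I ⊑ I ++ K ++ map (edge p) ts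
  hang-group {I = I} h group = extend λ J g →
    subst (Good _) (++-assoc J I _) (attach (∈-++⁺ʳ J h) group g)

  -- What is asked of the top of a group is what a placement grants its root.
  hang-rooted : ∀ {p c I K} → hang p ∈ I → Good c K → I ⊑ I ++ K ++ [ edge p c ]
  hang-rooted {p} {c} {K = K} h good = hang-group h λ { (_ ∷ unique) edges →
    let cs , P , R = good unique (edges ∘ there)
    in cs , P , λ { (here refl) → Rooted.root∈ R , Rooted.near-root R } }

  -- Two leaves at p are exchanged.  As their images are adjacent to p, it does
  -- not matter that p may move by as much as 4.
  twins : ∀ {p y z I} → node p ∈ I → I ⊑ I ++ (leafItems p (y ∷ z ∷ []) ++ map hang (y ∷ z ∷ []))
  twins {p} {y} {z} {I} node∈ = extend λ {r} J good → good-≼ (↭⇒≼ (↭-trans (↭-reflexive (++-assoc J I _)) (++⁺ˡ J (++⁺ˡ I reorder))))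
    (add J good)
    where
    ts : List A
    ts = y ∷ z ∷ []
    K : Items
    K = node y ∷ node z ∷ map hang ts
    reorder : K ++ map (edge p) ts ↭ leafItems p ts ++ map hang ts
    reorder = solve 6 (λ a b c d e f → a ⊕ b ⊕ c ⊕ d ⊕ e ⊕ f ⊜ a ⊕ e ⊕ b ⊕ f ⊕ c ⊕ d) ↭-refl
                [ node y ] [ node z ] [ hang y ] [ hang z ] [ edge p y ] [ edge p z ]
    add : ∀ {r} J → Good r (J ++ I) → Good r ((J ++ I) ++ K ++ map (edge p) ts)
    add {r} J good unique edges =
      let cs , P , R = good unique-I edges-I
          p∈ = node-∈ (∈-++⁺ʳ J node∈)
      in cs ++ [ ts ] ,
         attach-placed P placed unique′ p∈ ts⊆
           (λ t∈ m n → within-≤ (s≤s (s≤s (s≤s (s≤s (s≤s z≤n)))))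
             (within-trans (within-sym (Placed.near P m)) (step {k = 0} (adj (back n)) stay))) ,
         attach-rooted P placed unique′ p∈ ts⊆
           (λ t∈ m n → within-≤ (s≤s (s≤s (s≤s (s≤s (s≤s z≤n)))))
             (within-trans (within-sym (Placed.near P m)) (step {k = 0} (adj (back n)) stay)))
           (λ t∈ n → across n) R
      where
      open Attach {p} {J ++ I} {K} {ts} unique edges
      node-∈ : ∀ {a I} → node a ∈ I → a ∈ nodes I
      node-∈ {I = node _ ∷ _}   (here refl) = here refl
      node-∈ {I = node _ ∷ _}   (there q)   = there (node-∈ q)
      node-∈ {I = hang _ ∷ _}   (there q)   = node-∈ q
      node-∈ {I = edge _ _ ∷ _} (there q)   = node-∈ q
      ts⊆ : ∀ {t} → t ∈ ts → t ∈ nodes K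
      ts⊆ = id
      back : ∀ {t t′} → (t , t′) ∈ allSteps [ ts ] → t′ ∈ ts
      back (here refl)         = there (here refl)
      back (there (here refl)) = here refl
      across : ∀ {k t t′} → (t , t′) ∈ allSteps [ ts ] → Within (2 + k) t t′
      across (here refl)         = step (adj-sym (adj (here refl))) (step (adj (there (here refl))) stay)
      across (there (here refl)) = step (adj-sym (adj (there (here refl)))) (step (adj (here refl)) stay)
      no-edge : ∀ {a b} → ¬ edge a b ∈ K
      no-edge (there (there (there (there ()))))
      distinct : y ≢ z
      distinct with (q ∷ _) ∷ _ ← proj₁ (proj₂ (++-unique⁻ (nodes (J ++ I)) unique′)) = q
      placed : Placed K [ ts ]
      placed = record
        { cover     = ↭-refl
        ; short     = s≤s (s≤s z≤n) ∷ []
        ; ends      = ⊥-elim ∘ no-edge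
        ; hang-node = λ { (there (there (here refl))) → here refl
                        ; (there (there (there (here refl)))) → there (here refl) }
        ; moves     = λ { (here refl) → distinct ; (there (here refl)) → distinct ∘ sym }
        ; apart     = ⊥-elim ∘ no-edge
        ; image     = ⊥-elim ∘ no-edge
        ; near      = across
        ; near-hang = λ _ → across
        }

  openBranch-map : {B : Set} (f : B → A) (v : B) (k : Kind) (g : ℕ → B) →
                   map (mapItem f) (openBranch v (starAt k g)) ≡ openBranch (f v) (starAt k (f ∘ g))
  openBranch-map f v L  g = refl
  openBranch-map f v C₁ g = refl
  openBranch-map f v C₂ g = refl
  openBranch-map f v D₁ g = refl
  openBranch-map f v D₂ g = refl

  closedBranch-map : {B : Set} (f : B → A) (v : B) (k : Kind) (g : ℕ → B) →
                     map (mapItem f) (closedBranch v (starAt k g)) ≡ closedBranch (f v) (starAt k (f ∘ g))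
  closedBranch-map f v L  g = refl
  closedBranch-map f v C₁ g = refl
  closedBranch-map f v C₂ g = refl
  closedBranch-map f v D₁ g = refl
  closedBranch-map f v D₂ g = refl

  closed-map : {B : Set} (f : B → A) (k : Kind) (g : ℕ → B) →
               map (mapItem f) (closed (starAt k g)) ≡ closed (starAt k (f ∘ g))
  closed-map f L  g = refl
  closed-map f C₁ g = refl
  closed-map f C₂ g = refl
  closed-map f D₁ g = refl
  closed-map f D₂ g = refl

  good-shape : ∀ {I r} (f : Label → A) → RootedShape I r → Good (f r) (map (mapItem f) I)
  good-shape {I} f (cs , P , R) unique edges = map (map f) cs , placed P unique , rooted P unique R
    where
    hom : ∀ {a b} → IsEdge I a b → Adj (f a) (f b)
    hom (inj₁ e) = edges (∈-map⁺ (mapItem f) e)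
    hom (inj₂ e) = adj-sym (edges (∈-map⁺ (mapItem f) e))
    open Relabel (IsEdge I) (isEdge-sym I) Adj adj-sym f hom

  group-shape : ∀ {p I ts} (f : Label → A) → GroupShape p I ts → Group (f p) (map (mapItem f) I) (map f ts)
  group-shape {p} {I} {ts} f (cs , P , tops) (_ ∷ unique) edges = map (map f) cs , placed P unique , near-tops
    where
    M = map (edge p) ts ++ I
    edges-M : ∀ {a b} → edge a b ∈ M → Adj (f a) (f b)
    edges-M e with ∈-++⁻ (map (edge p) ts) e
    ... | inj₂ e₂ = edges (∈-++⁺ʳ _ (∈-map⁺ (mapItem f) e₂))
    ... | inj₁ e₁ with t , t∈ , refl ← ∈-map⁻ (edge p) e₁ = edges (∈-++⁺ˡ (∈-map⁺ (edge (f p)) (∈-map⁺ f t∈)))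
    hom : ∀ {a b} → IsEdge M a b → Adj (f a) (f b)
    hom (inj₁ e) = edges-M e
    hom (inj₂ e) = adj-sym (edges-M e)
    open Relabel (IsEdge M) (isEdge-sym M) Adj adj-sym f hom
    near-tops : ∀ {t} → t ∈ map f ts → t ∈ nodes (map (mapItem f) I) ×
                (∀ {t′} → (t , t′) ∈ allSteps (map (map f) cs) → Within 2 t t′)
    near-tops t∈ with t , t∈′ , refl ← ∈-map⁻ f t∈ =
      let t∈I , near = All.lookup tops t∈′ in post P unique t∈I , top-near P unique t∈I near

  kind∈ : ∀ k → k ∈ kinds
  kind∈ L  = here refl
  kind∈ C₁ = there (here refl)
  kind∈ C₂ = there (there (here refl))
  kind∈ D₁ = there (there (there (here refl)))
  kind∈ D₂ = there (there (there (there (here refl))))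

  labelling : A → (ℕ → A) → (ℕ → A) → (ℕ → A) → Label → A
  labelling v g h y (0 , _)                 = v
  labelling v g h y (1 , i)                 = g i
  labelling v g h y (2 , i)                 = h i
  labelling v g h y (suc (suc (suc _)) , i) = y i

  good-main : ∀ {k l ks r} v g h y → l ∈ bigKinds → ks ∈ tails → r ∈ mainRoots k →
              Good (labelling v g h y r) (mainItems v (starAt k g) (starAt l h) (map (λ m → starAt m y) ks))
  good-main {k} {l} {ks} {r} v g h y l∈ ks∈ r∈ =
    subst (Good (f r)) (cong (λ I → node v ∷ hang v ∷ I) eq) (good-shape f
      (All.lookup (All.lookup (All.lookup (All.lookup main-table (kind∈ k)) l∈) ks∈) r∈))
    where
    f = labelling v g h y
    c = 0 , 0
    tails-eq : ∀ ks → map (mapItem f) (concatMap (closedBranch c) (map (λ m → starAt m (3 ,_)) ks)) ≡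
               concatMap (closedBranch v) (map (λ m → starAt m y) ks)
    tails-eq []       = refl
    tails-eq (m ∷ ks) = trans (map-++ (mapItem f) (closedBranch c (starAt m (3 ,_))) _)
                          (cong₂ _++_ (closedBranch-map f c m (3 ,_)) (tails-eq ks))
    eq : map (mapItem f) (openBranch c (starAt k (1 ,_)) ++ openBranch c (starAt l (2 ,_)) ++
           concatMap (closedBranch c) (map (λ m → starAt m (3 ,_)) ks)) ≡
         openBranch v (starAt k g) ++ openBranch v (starAt l h) ++ concatMap (closedBranch v) (map (λ m → starAt m y) ks)
    eq = trans (map-++ (mapItem f) (openBranch c (starAt k (1 ,_))) _)
           (cong₂ _++_ (openBranch-map f c k (1 ,_))
             (trans (map-++ (mapItem f) (openBranch c (starAt l (2 ,_))) _)
               (cong₂ _++_ (openBranch-map f c l (2 ,_)) (tails-eq ks))))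

  good-lone : ∀ {k} v g → k ∈ D₁ ∷ D₂ ∷ [] → Good v (coreItems v (starAt k g) [])
  good-lone {k} v g k∈ = subst (Good v) (cong (λ I → node v ∷ hang v ∷ I)
    (trans (map-++ (mapItem f) (openBranch (0 , 0) (starAt k (1 ,_))) []) (cong (_++ []) (openBranch-map f (0 , 0) k (1 ,_)))))
    (good-shape f (All.lookup lone-table k∈))
    where f = labelling v g g g

  group-pair : ∀ k l v g h → Group v (pairItems (starAt k g) (starAt l h)) (g 0 ∷ h 0 ∷ [])
  group-pair k l v g h = subst (λ I → Group v I (g 0 ∷ h 0 ∷ []))
    (trans (map-++ (mapItem f) (closed (starAt k (1 ,_))) _) (cong₂ _++_ (closed-map f k (1 ,_)) (closed-map f l (2 ,_))))
    (group-shape f (All.lookup (All.lookup pair-table (kind∈ k)) (kind∈ l)))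
    where f = labelling v g h h

  -- Removing leaves and branches in pairs

  starLeaves : A → List A → Items
  starLeaves b ls = node b ∷ leafItems b ls ++ map hang ls

  odd-one : List A → Maybe A
  odd-one []           = nothing
  odd-one (y ∷ [])     = just y
  odd-one (_ ∷ _ ∷ ls) = odd-one ls

  -- The pairs come off by `twins`. The first leaf stays: the root may lie there, and the star has
  -- to keep a leaf.
  strip-leaves : ∀ b l ls → starLeaves b (l ∷ fromMaybe (odd-one ls)) ⊑ starLeaves b (l ∷ ls)
  strip-leaves b l []           = ⊑-refl
  strip-leaves b l (y ∷ [])     = ⊑-refl
  strip-leaves b l (y ∷ z ∷ ls) = strip-leaves b l ls ⨾ twins {b} {y} {z} (here refl) ⨾ ↭⇒⊑
    (solve 8 (λ n l′ ls′ h hs yz hy hz → ((n ⊕ l′ ⊕ ls′) ⊕ h ⊕ hs) ⊕ yz ⊕ hy ⊕ hz ⊜ n ⊕ (l′ ⊕ yz ⊕ ls′) ⊕ h ⊕ hy ⊕ hz ⊕ hs)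
      ↭-refl [ node b ] (node l ∷ [ edge b l ]) (leafItems b ls) [ hang l ] (map hang ls)
        (leafItems b (y ∷ z ∷ [])) [ hang y ] [ hang z ])

  open-cen : ∀ c ls → [ hang c ] ++ starLeaves c ls ↭ open′ (cen c ls)
  open-cen c ls = solve 4 (λ h n l hs → h ⊕ n ⊕ l ⊕ hs ⊜ (n ⊕ l) ⊕ h ⊕ hs) ↭-refl
    [ hang c ] [ node c ] (leafItems c ls) (map hang ls)

  open-tip : ∀ a b l ls → (node a ∷ edge a b ∷ hang a ∷ [ hang b ]) ++ starLeaves b (l ∷ ls) ↭ open′ (tip a b l ls)
  open-tip a b l ls = solve 7 (λ na e ha hb nb lf hs → (na ⊕ e ⊕ ha ⊕ hb) ⊕ nb ⊕ lf ⊕ hs ⊜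
                                                     (na ⊕ e ⊕ nb ⊕ lf) ⊕ ha ⊕ hb ⊕ hs) ↭-refl
    [ node a ] [ edge a b ] [ hang a ] [ hang b ] [ node b ] (leafItems b (l ∷ ls)) (map hang (l ∷ ls))

  closed-tip : ∀ a b l ls → (node a ∷ edge a b ∷ [ hang a ]) ++ starLeaves b (l ∷ ls) ↭ closed (tip a b l ls)
  closed-tip a b l ls = solve 6 (λ na e ha nb lf hs → (na ⊕ e ⊕ ha) ⊕ nb ⊕ lf ⊕ hs ⊜
                                                      (na ⊕ e ⊕ nb ⊕ lf) ⊕ ha ⊕ hs) ↭-refl
    [ node a ] [ edge a b ] [ hang a ] [ node b ] (leafItems b (l ∷ ls)) (map hang (l ∷ ls))

  strip-cen : ∀ c l ls → open′ (cen c (l ∷ fromMaybe (odd-one ls))) ⊑ open′ (cen c (l ∷ ls))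
  strip-cen c l ls = ↭⇒⊑ (↭-sym (open-cen c (l ∷ fromMaybe (odd-one ls)))) ⨾
    ⊑-++ˡ [ hang c ] (strip-leaves c l ls) ⨾ ↭⇒⊑ (open-cen c (l ∷ ls))

  strip-tip : ∀ a b l ls → open′ (tip a b l (fromMaybe (odd-one ls))) ⊑ open′ (tip a b l ls)
  strip-tip a b l ls = ↭⇒⊑ (↭-sym (open-tip a b l (fromMaybe (odd-one ls)))) ⨾
    ⊑-++ˡ (node a ∷ edge a b ∷ hang a ∷ [ hang b ]) (strip-leaves b l ls) ⨾ ↭⇒⊑ (open-tip a b l ls)

  strip-tip-closed : ∀ a b l ls → closed (tip a b l (fromMaybe (odd-one ls))) ⊑ closed (tip a b l ls)
  strip-tip-closed a b l ls = ↭⇒⊑ (↭-sym (closed-tip a b l (fromMaybe (odd-one ls)))) ⨾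
    ⊑-++ˡ (node a ∷ edge a b ∷ [ hang a ]) (strip-leaves b l ls) ⨾ ↭⇒⊑ (closed-tip a b l ls)

  open⊑closed : ∀ s → open′ s ⊑ closed s
  open⊑closed (cen c ls)     = ⊑-refl
  open⊑closed (tip a b l ls) = ↭⇒⊑ (solve 4 (λ p ha hb hs → p ⊕ ha ⊕ hb ⊕ hs ⊜ (p ⊕ ha ⊕ hs) ⊕ hb) ↭-refl
    (plain (tip a b l ls)) [ hang a ] [ hang b ] (map hang (l ∷ ls))) ⨾
    ⊑-++ˡ (closed (tip a b l ls)) (unhang [ b ]) ⨾ ↭⇒⊑ (↭-reflexive (++-identityʳ _))

  data Big : Star A → Set where
    cen : ∀ {c l ls} → Big (cen c (l ∷ ls))
    tip : ∀ {a b l ls} → Big (tip a b l ls)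

  data Tip : Star A → Set where
    tip : ∀ {a b l ls} → Tip (tip a b l ls)

  -- Where the root may lie in a star, after the leaves have been permuted.
  data Marked : A → Star A → Set where
    at-top   : ∀ {s} → Marked (top s) s
    cen-leaf : ∀ {c l ls} → Marked l (cen c (l ∷ ls))
    tip-cen  : ∀ {a b l ls} → Marked b (tip a b l ls)
    tip-leaf : ∀ {a b l ls} → Marked l (tip a b l ls)

  record Strip (s : Star A) : Set where
    field
      kind   : Kind
      label  : ℕ → A
      top≡   : label 0 ≡ top s
      top′   : top (starAt kind label) ≡ label 0
      open⊑  : open′ (starAt kind label) ⊑ open′ s
      closed⊑ : closed (starAt kind label) ⊑ closed s
      kind-big : Big s → kind ∈ bigKinds
      kind-tip : Tip s → kind ∈ D₁ ∷ D₂ ∷ []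
      mark : ∀ {r} → Marked r s → ∃[ i ] i ∈ marks kind × label i ≡ r

  private
    nth : A → List A → ℕ → A
    nth d []       _       = d
    nth d (a ∷ as) zero    = a
    nth d (a ∷ as) (suc i) = nth d as i

  private
    -- `m` generalises `odd-one ls`, so that it can be matched on after the reduction has been
    -- proved.
    strip-cen′ : ∀ {c l ls} m → open′ (cen c (l ∷ fromMaybe m)) ⊑ open′ (cen c (l ∷ ls)) → Strip (cen c (l ∷ ls))
    strip-cen′ {c} {l} nothing le = record
      { kind = C₁ ; label = nth c (c ∷ l ∷ []) ; top≡ = refl ; top′ = refl ; open⊑ = le ; closed⊑ = le
      ; kind-big = λ _ → here refl ; kind-tip = λ ()
      ; mark = λ { at-top → 0 , here refl , refl ; cen-leaf → 1 , there (here refl) , refl } }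
    strip-cen′ {c} {l} (just y) le = record
      { kind = C₂ ; label = nth c (c ∷ l ∷ y ∷ []) ; top≡ = refl ; top′ = refl ; open⊑ = le ; closed⊑ = le
      ; kind-big = λ _ → there (here refl) ; kind-tip = λ ()
      ; mark = λ { at-top → 0 , here refl , refl ; cen-leaf → 1 , there (here refl) , refl } }

    strip-tip′ : ∀ {a b l ls} m → open′ (tip a b l (fromMaybe m)) ⊑ open′ (tip a b l ls) →
                 closed (tip a b l (fromMaybe m)) ⊑ closed (tip a b l ls) → Strip (tip a b l ls)
    strip-tip′ {a} {b} {l} nothing le le′ = record
      { kind = D₁ ; label = nth a (a ∷ b ∷ l ∷ []) ; top≡ = refl ; top′ = refl ; open⊑ = le ; closed⊑ = le′
      ; kind-big = λ _ → there (there (here refl)) ; kind-tip = λ _ → here refl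
      ; mark = λ { at-top → 0 , here refl , refl ; tip-cen → 1 , there (here refl) , refl
                 ; tip-leaf → 2 , there (there (here refl)) , refl } }
    strip-tip′ {a} {b} {l} (just y) le le′ = record
      { kind = D₂ ; label = nth a (a ∷ b ∷ l ∷ y ∷ []) ; top≡ = refl ; top′ = refl ; open⊑ = le ; closed⊑ = le′
      ; kind-big = λ _ → there (there (there (here refl))) ; kind-tip = λ _ → there (here refl)
      ; mark = λ { at-top → 0 , here refl , refl ; tip-cen → 1 , there (here refl) , refl
                 ; tip-leaf → 2 , there (there (here refl)) , refl } }

  strip : ∀ s → Strip s
  strip (cen c []) = record
    { kind = L ; label = nth c [ c ] ; top≡ = refl ; top′ = refl ; open⊑ = ⊑-refl ; closed⊑ = ⊑-refl
    ; kind-big = λ () ; kind-tip = λ () ; mark = λ { at-top → 0 , here refl , refl } }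
  strip (cen c (l ∷ ls))   = strip-cen′ (odd-one ls) (strip-cen c l ls)
  strip (tip a b l ls)     = strip-tip′ (odd-one ls) (strip-tip a b l ls) (strip-tip-closed a b l ls)

  module _ (v : A) (s : Star A) where
    open Strip (strip s)

    stripped : Star A
    stripped = starAt kind label

    top-stripped : top stripped ≡ top s
    top-stripped = trans top′ top≡

    strip-open : openBranch v stripped ⊑ openBranch v s
    strip-open = subst (λ t → edge v t ∷ open′ stripped ⊑ openBranch v s) (sym top-stripped)
      (⊑-++ˡ [ edge v (top s) ] open⊑)

    strip-closed : closedBranch v stripped ⊑ closedBranch v s
    strip-closed = subst (λ t → edge v t ∷ closed stripped ⊑ closedBranch v s) (sym top-stripped)
      (⊑-++ˡ [ edge v (top s) ] closed⊑)

  closedBranches : A → List (Star A) → Items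
  closedBranches v = concatMap (closedBranch v)

  -- Any two branches will do: side by side two stars can be placed, although neither has a
  -- fixed-point-free 2-placement of its own.
  drop-pair : ∀ {v I} X Y → hang v ∈ I → I ⊑ I ++ closedBranch v X ++ closedBranch v Y
  drop-pair {v} {I} X Y h =
    hang-group h (group-pair X.kind Y.kind v X.label Y.label) ⨾ ⊑-++ˡ I
      (↭⇒⊑ reorder ⨾ ⊑-++ (branch X) (branch Y))
    where
    module X = Strip (strip X)
    module Y = Strip (strip Y)
    X′ = stripped v X
    Y′ = stripped v Y
    reorder : pairItems X′ Y′ ++ edge v (X.label 0) ∷ edge v (Y.label 0) ∷ [] ↭
              (edge v (X.label 0) ∷ closed X′) ++ (edge v (Y.label 0) ∷ closed Y′)
    reorder = solve 4 (λ x y e f → (x ⊕ y) ⊕ e ⊕ f ⊜ (e ⊕ x) ⊕ f ⊕ y) ↭-refl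
      (closed X′) (closed Y′) [ edge v (X.label 0) ] [ edge v (Y.label 0) ]
    branch : ∀ Z → edge v (Strip.label (strip Z) 0) ∷ closed (stripped v Z) ⊑ closedBranch v Z
    branch Z = subst (λ t → edge v t ∷ closed (stripped v Z) ⊑ closedBranch v Z) (sym (Strip.top≡ (strip Z)))
      (⊑-++ˡ [ edge v (top Z) ] (Strip.closed⊑ (strip Z)))

  data RootIn (v : A) (S : Star A) : A → Set where
    at-hub : RootIn v S v
    in-S   : ∀ {r} → Marked r S → RootIn v S r

  good-stripped : ∀ {v S W r} Ys ks y → Big W → RootIn v S r → ks ∈ tails →
                  closedBranches v (map (λ k → starAt k y) ks) ⊑ closedBranches v Ys → Good r (mainItems v S W Ys)
  good-stripped {v} {S} {W} Ys ks y big root ks∈ le = from-root root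
    where
    module S = Strip (strip S)
    module W = Strip (strip W)
    main⊑ : mainItems v (starAt S.kind S.label) (starAt W.kind W.label) (map (λ k → starAt k y) ks) ⊑ mainItems v S W Ys
    main⊑ = ⊑-++ˡ (node v ∷ [ hang v ]) (⊑-++ (strip-open v S) (⊑-++ (strip-open v W) le))
    good : ∀ {r} → r ∈ mainRoots S.kind → Good (labelling v S.label W.label y r) (mainItems v S W Ys)
    good r∈ = good-⊑ main⊑ (good-main v S.label W.label y (W.kind-big big) ks∈ r∈)
    from-root : ∀ {r} → RootIn v S r → Good r (mainItems v S W Ys)
    from-root at-hub = good (here refl)
    from-root (in-S m) with i , i∈ , refl ← S.mark m = good (there (∈-map⁺ (1 ,_) i∈))

  -- `S` and `W` are never dropped: `S` may contain the root, and `W`, having at least two vertices,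
  -- keeps the remainder from being a star with centre `v`.
  good-stars : ∀ {v S W r} Ys → Big W → RootIn v S r → Good r (mainItems v S W Ys)
  good-stars {v} {S} [] big root =
    good-stripped [] [] (Strip.label (strip S)) big root (here refl) ⊑-refl
  good-stars {v} (Y ∷ []) big root =
    good-stripped [ Y ] [ Y.kind ] Y.label big root (there (∈-map⁺ [_] (kind∈ Y.kind))) (⊑-++ʳ [] (strip-closed v Y))
    where module Y = Strip (strip Y)
  good-stars {v} {S} {W} (X ∷ Y ∷ Ys) big root =
    good-⊑ (drop-pair X Y (there (here refl)) ⨾ ↭⇒⊑
      (solve 6 (λ n s w ys x y → (n ⊕ s ⊕ w ⊕ ys) ⊕ x ⊕ y ⊜ n ⊕ s ⊕ w ⊕ x ⊕ y ⊕ ys) ↭-refl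
        (node v ∷ [ hang v ]) (openBranch v S) (openBranch v W) (closedBranches v Ys)
        (closedBranch v X) (closedBranch v Y)))
      (good-stars Ys big root)

  -- Not a star: with a single branch, this has to be a tip.
  NonStar : Star A → List (Star A) → Set
  NonStar W Xs = Big W × (Xs ≡ [] → Tip W)

  -- With the root at the hub, any further branch can play the part of `S`.
  good-core : ∀ {v W} Xs → NonStar W Xs → Good v (coreItems v W Xs)
  good-core {v} {W} [] (_ , is-tip) = good-⊑ (⊑-++ˡ (node v ∷ [ hang v ]) (⊑-++ʳ [] (strip-open v W)))
    (good-lone v (Strip.label (strip W)) (Strip.kind-tip (strip W) (is-tip refl)))
  good-core {v} {W} (X ∷ Xs) (big , _) = good-⊑ (↭⇒⊑
      (solve 4 (λ n x w xs → n ⊕ x ⊕ w ⊕ xs ⊜ n ⊕ w ⊕ x ⊕ xs) ↭-refl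
        (node v ∷ [ hang v ]) (openBranch v X) (openBranch v W) (closedBranches v Xs)) ⨾
      ⊑-++ˡ (node v ∷ hang v ∷ openBranch v W) (⊑-++ʳ (closedBranches v Xs) (⊑-++ˡ [ edge v (top X) ] (open⊑closed X))))
    (good-stars {S = X} Xs big at-hub)

  -- Stars seen from another vertex

  pick : ∀ {p} (b : A) {ls} → p ∈ ls → ∃[ ls′ ] leafItems b (p ∷ ls′) ↭ leafItems b ls × map hang (p ∷ ls′) ↭ map hang ls
  pick b {_ ∷ ls} (here refl) = ls , ↭-refl , ↭-refl
  pick {p} b {l ∷ ls} (there p∈) =
    let ls′ , q , q′ = pick b p∈ in
    l ∷ ls′ ,
    ↭-trans (shifts (leafItems b [ p ]) (leafItems b [ l ])) (++⁺ˡ (leafItems b [ l ]) q) ,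
    ↭-trans (swap (hang p) (hang l) ↭-refl) (prep (hang l) q′)

  -- The old top is where the root of the tree lies, so it has to end up at a position covered by
  -- the tables.
  Rerooted : A → Star A → Set
  Rerooted p s = ∃[ s′ ] top s′ ≡ p × Marked (top s) s′ × open′ s′ ⊑ open′ s

  reroot-leaf : ∀ {u ls p} ls′ → leafItems u (p ∷ ls′) ↭ leafItems u ls → map hang (p ∷ ls′) ↭ map hang ls →
                Rerooted p (cen u ls)
  reroot-leaf {u} {ls} {p} [] q q′ = cen p [ u ] , refl , cen-leaf ,
    ⊑-++ˡ (node p ∷ [ node u ]) (⊑-++ʳ (hang p ∷ [ hang u ]) flip) ⨾ ↭⇒⊑
      (↭-trans (solve 5 (λ np nu e hp hu → np ⊕ nu ⊕ e ⊕ hp ⊕ hu ⊜ nu ⊕ (np ⊕ e) ⊕ hu ⊕ hp) ↭-refl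
         [ node p ] [ node u ] [ edge u p ] [ hang p ] [ hang u ])
       (prep (node u) (++⁺ q (prep (hang u) q′))))
  reroot-leaf {u} {ls} {p} (l ∷ ls′) q q′ = tip p u l ls′ , refl , tip-cen ,
    ⊑-++ˡ [ node p ] (⊑-++ʳ (node u ∷ leafItems u (l ∷ ls′) ++ map hang (p ∷ u ∷ l ∷ ls′)) flip) ⨾ ↭⇒⊑
      (↭-trans (solve 7 (λ np nu e lf hp hu hs → np ⊕ e ⊕ nu ⊕ lf ⊕ hp ⊕ hu ⊕ hs ⊜ nu ⊕ (np ⊕ e ⊕ lf) ⊕ hu ⊕ hp ⊕ hs) ↭-refl
         [ node p ] [ node u ] [ edge u p ] (leafItems u (l ∷ ls′)) [ hang p ] [ hang u ] (map hang (l ∷ ls′)))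
       (prep (node u) (++⁺ q (prep (hang u) q′))))

  reroot-other : ∀ {u b l ls p} ls′ → leafItems b (p ∷ ls′) ↭ leafItems b (l ∷ ls) →
                 map hang (p ∷ ls′) ↭ map hang (l ∷ ls) → Rerooted p (tip u b l ls)
  reroot-other {u} {b} {l} {ls} {p} ls′ q q′ = tip p b u ls′ , refl , tip-leaf ,
    ↭⇒⊑ (solve 8 (λ np e nb nu f lf hpb hr → (np ⊕ e ⊕ nb ⊕ nu ⊕ f ⊕ lf) ⊕ hpb ⊕ hr ⊜ (e ⊕ f) ⊕ np ⊕ nb ⊕ nu ⊕ lf ⊕ hpb ⊕ hr) ↭-refl
      [ node p ] [ edge p b ] [ node b ] [ node u ] [ edge b u ] (leafItems b ls′) (hang p ∷ [ hang b ]) (map hang (u ∷ ls′))) ⨾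
    ⊑-++ʳ _ (⊑-++ flip flip) ⨾
    ↭⇒⊑ (↭-trans
      (solve 10 (λ np e nb nu f lf hp hb hu hr → (e ⊕ f) ⊕ np ⊕ nb ⊕ nu ⊕ lf ⊕ (hp ⊕ hb) ⊕ hu ⊕ hr ⊜
                                                (nu ⊕ f ⊕ nb ⊕ np ⊕ e ⊕ lf) ⊕ hu ⊕ hb ⊕ hp ⊕ hr) ↭-refl
        [ node p ] [ edge b p ] [ node b ] [ node u ] [ edge u b ] (leafItems b ls′) [ hang p ] [ hang b ] [ hang u ] (map hang ls′))
      (++⁺ (++⁺ˡ (node u ∷ edge u b ∷ [ node b ]) q) (++⁺ˡ (hang u ∷ [ hang b ]) q′)))

  reroot : ∀ s {p} → p ∈ verts s → Rerooted p s
  reroot (cen u ls) (here refl) = cen u ls , refl , at-top , ⊑-refl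
  reroot (cen u ls) (there p∈) = let ls′ , q , q′ = pick u p∈ in reroot-leaf ls′ q q′
  reroot (tip u b l ls) (here refl) = tip u b l ls , refl , at-top , ⊑-refl
  reroot (tip u b l ls) (there (here refl)) = cen b (u ∷ l ∷ ls) , refl , cen-leaf ,
    ↭⇒⊑ (solve 6 (λ nb nu e lf hb hr → (nb ⊕ nu ⊕ e ⊕ lf) ⊕ hb ⊕ hr ⊜ e ⊕ (nu ⊕ nb ⊕ lf) ⊕ hb ⊕ hr) ↭-refl
      [ node b ] [ node u ] [ edge b u ] (leafItems b (l ∷ ls)) [ hang b ] (map hang (u ∷ l ∷ ls))) ⨾
    ⊑-++ʳ _ flip ⨾
    ↭⇒⊑ (solve 7 (λ nb nu e lf hb hu hr → e ⊕ (nu ⊕ nb ⊕ lf) ⊕ hb ⊕ hu ⊕ hr ⊜ (nu ⊕ e ⊕ nb ⊕ lf) ⊕ hu ⊕ hb ⊕ hr) ↭-refl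
      [ node b ] [ node u ] [ edge u b ] (leafItems b (l ∷ ls)) [ hang b ] [ hang u ] (map hang (l ∷ ls)))
  reroot (tip u b l ls) (there (there p∈)) = let ls′ , q , q′ = pick b p∈ in reroot-other ls′ q q′

  -- Seen from `v`, the star `s` is one more branch at the hub: turned so that `p` becomes its top,
  -- it takes the part of `S`, with the root inside it.
  good-pend : ∀ {s p v W} Xs → NonStar W Xs → p ∈ verts s →
              Good (top s) (open′ s ++ [ edge p v ] ++ coreItems v W Xs)
  good-pend {s} {p} {v} {W} Xs (big , _) p∈ with S , refl , m , le ← reroot s p∈ =
    good-⊑ (↭⇒⊑ (solve 4 (λ n e o w → n ⊕ (e ⊕ o) ⊕ w ⊜ e ⊕ o ⊕ n ⊕ w) ↭-refl
        (node v ∷ [ hang v ]) [ edge v (top S) ] (open′ S) (openBranch v W ++ closedBranches v Xs)) ⨾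
      ⊑-++ flip (⊑-++ʳ (coreItems v W Xs) le) ⨾
      ↭⇒⊑ (shifts [ edge (top S) v ] (open′ s)))
    (good-stars Xs big (in-S m))

  -- Joining two pieces by an edge

  leafBranches : ∀ u ls → closedBranches u (map (λ l → cen l []) ls) ↭ leafItems u ls ++ map hang ls
  leafBranches u []       = ↭-refl
  leafBranches u (l ∷ ls) = ↭-trans (++⁺ˡ (edge u l ∷ node l ∷ [ hang l ]) (leafBranches u ls))
    (solve 5 (λ e n h ls hs → (e ⊕ n ⊕ h) ⊕ ls ⊕ hs ⊜ (n ⊕ e ⊕ ls) ⊕ h ⊕ hs) ↭-refl
      [ edge u l ] [ node l ] [ hang l ] (leafItems u ls) (map hang ls))

  data Joined (s s′ : Star A) : Set where
    enlarged : ∀ s″ → top s″ ≡ top s → (∀ {p} → p ∈ verts s → p ∈ verts s″) → (∀ {p} → p ∈ verts s′ → p ∈ verts s″) →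
           plain s″ ↭ plain s ++ plain s′ ++ [ edge (top s) (top s′) ] →
           open′ s″ ↭ open′ s ++ open′ s′ ++ [ edge (top s) (top s′) ] → Joined s s′
    core : ∀ W Xs → NonStar W Xs →
           coreItems (top s) W Xs ↭ open′ s ++ open′ s′ ++ [ edge (top s) (top s′) ] → Joined s s′

  private
    core-cen : ∀ u l ls s → coreItems u s (map (λ l → cen l []) (l ∷ ls)) ↭
               open′ (cen u (l ∷ ls)) ++ open′ s ++ [ edge u (top s) ]
    core-cen u l ls s = ↭-trans
      (++⁺ˡ (node u ∷ hang u ∷ openBranch u s) (leafBranches u (l ∷ ls)))
      (solve 6 (λ n h e o lf hs → n ⊕ h ⊕ (e ⊕ o) ⊕ lf ⊕ hs ⊜ ((n ⊕ lf) ⊕ h ⊕ hs) ⊕ o ⊕ e) ↭-refl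
        [ node u ] [ hang u ] [ edge u (top s) ] (open′ s) (leafItems u (l ∷ ls)) (map hang (l ∷ ls)))

    core-tip : ∀ u b l ls s → (node u ∷ [ hang u ]) ++ (edge u b ∷ open′ (cen b (l ∷ ls))) ++ (edge u (top s) ∷ open′ s) ↭
               open′ (tip u b l ls) ++ open′ s ++ [ edge u (top s) ]
    core-tip u b l ls s =
      solve 9 (λ nu hu e nb lf hb hs f o → (nu ⊕ hu) ⊕ (e ⊕ (nb ⊕ lf) ⊕ hb ⊕ hs) ⊕ f ⊕ o ⊜
                                           ((nu ⊕ e ⊕ nb ⊕ lf) ⊕ hu ⊕ hb ⊕ hs) ⊕ o ⊕ f) ↭-refl
        [ node u ] [ hang u ] [ edge u b ] [ node b ] (leafItems b (l ∷ ls)) [ hang b ] (map hang (l ∷ ls))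
        [ edge u (top s) ] (open′ s)

    core-tip-big : ∀ u b l ls s → coreItems u s [ cen b (l ∷ ls) ] ↭
                   open′ (tip u b l ls) ++ open′ s ++ [ edge u (top s) ]
    core-tip-big u b l ls s = ↭-trans
      (solve 3 (λ n w x → n ⊕ w ⊕ x ⊕ ε ⊜ n ⊕ x ⊕ w) ↭-refl
        (node u ∷ [ hang u ]) (openBranch u s) (openBranch u (cen b (l ∷ ls))))
      (core-tip u b l ls s)

  -- In a core only `W` is open, whereas all vertices of both stars must keep their `hang`. So if
  -- the result is a core, a tip `s′` becomes `W`, and `s` breaks up into branches attached by their
  -- centres, for which `closed` and `open′` agree.
  joinStar : ∀ s s′ → Joined s s′
  joinStar (cen u ls) (cen c []) = enlarged (cen u (c ∷ ls)) refl
    (λ { (here e) → here e ; (there p) → there (there p) }) (λ { (here e) → there (here e) })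
    (solve 4 (λ nu nc e lf → nu ⊕ (nc ⊕ e) ⊕ lf ⊜ (nu ⊕ lf) ⊕ nc ⊕ e) ↭-refl
      [ node u ] [ node c ] [ edge u c ] (leafItems u ls))
    (solve 7 (λ nu nc e lf hu hc hs → (nu ⊕ (nc ⊕ e) ⊕ lf) ⊕ hu ⊕ hc ⊕ hs ⊜ ((nu ⊕ lf) ⊕ hu ⊕ hs) ⊕ (nc ⊕ hc) ⊕ e) ↭-refl
      [ node u ] [ node c ] [ edge u c ] (leafItems u ls) [ hang u ] [ hang c ] (map hang ls))
  joinStar (cen u []) (cen c (l ∷ ls)) = enlarged (tip u c l ls) refl
    (λ { (here e) → here e }) there
    (solve 4 (λ nu nc e lf → nu ⊕ e ⊕ nc ⊕ lf ⊜ nu ⊕ (nc ⊕ lf) ⊕ e) ↭-refl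
      [ node u ] [ node c ] [ edge u c ] (leafItems c (l ∷ ls)))
    (solve 6 (λ nu nc e lf hu hr → (nu ⊕ e ⊕ nc ⊕ lf) ⊕ hu ⊕ hr ⊜ (nu ⊕ hu) ⊕ ((nc ⊕ lf) ⊕ hr) ⊕ e) ↭-refl
      [ node u ] [ node c ] [ edge u c ] (leafItems c (l ∷ ls)) [ hang u ] (map hang (c ∷ l ∷ ls)))
  joinStar (cen u []) (tip c b l ls) = core (tip c b l ls) [] (tip , λ _ → tip)
    (solve 4 (λ n h e o → n ⊕ h ⊕ (e ⊕ o) ⊕ ε ⊜ (n ⊕ h) ⊕ o ⊕ e) ↭-refl
      [ node u ] [ hang u ] [ edge u c ] (open′ (tip c b l ls)))
  joinStar (cen u (l ∷ ls)) (cen c (m ∷ ms)) =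
    core (cen c (m ∷ ms)) (map (λ l → cen l []) (l ∷ ls)) (cen , λ ()) (core-cen u l ls (cen c (m ∷ ms)))
  joinStar (cen u (l ∷ ls)) (tip c b m ms) =
    core (tip c b m ms) (map (λ l → cen l []) (l ∷ ls)) (tip , λ ()) (core-cen u l ls (tip c b m ms))
  joinStar (tip u b l ls) (cen c [])         = core (cen b (l ∷ ls)) [ cen c [] ] (cen , λ ()) (core-tip u b l ls (cen c []))
  joinStar (tip u b l ls) (cen c (m ∷ ms)) =
    core (cen c (m ∷ ms)) [ cen b (l ∷ ls) ] (cen , λ ()) (core-tip-big u b l ls (cen c (m ∷ ms)))
  joinStar (tip u b l ls) (tip c d m ms) =
    core (tip c d m ms) [ cen b (l ∷ ls) ] (tip , λ ()) (core-tip-big u b l ls (tip c d m ms))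

  -- What is left of a rooted tree after groups of vertices have been split off: a star, which is
  -- then the whole tree; a hub, which is the root, with star branches; or such a hub hung from a
  -- star that contains the root.
  data State : A → Items → Set where
    -- A permutation instead of `⊑`: this case is refuted in the end by an isomorphism with a star.
    whole : ∀ {I} s → plain s ↭ I → State (top s) I
    -- `hang r` is promised because later joins may hang groups from the root.
    core : ∀ {r I} W Xs → NonStar W Xs → coreItems r W Xs ⊑ I ++ [ hang r ] → State r I
    pend : ∀ {I p v} s W Xs → p ∈ verts s → NonStar W Xs →
           open′ s ++ [ edge p v ] ++ coreItems v W Xs ⊑ I ++ [ hang (top s) ] → State (top s) I

  -- Once it is joined to its parent, `c` receives no further children, so its `hang` is given up.
  glue : ∀ {r c I I′ J J′} → I′ ⊑ I ++ [ hang r ] → J′ ⊑ J ++ [ hang c ] →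
         I′ ++ J′ ++ [ edge r c ] ⊑ (I ++ J ++ [ edge r c ]) ++ [ hang r ]
  glue {r} {c} {I} {J = J} p q = ⊑-++ p (⊑-++ʳ [ edge r c ] q) ⨾
    ↭⇒⊑ (solve 5 (λ i j e hr hc → (i ⊕ hr) ⊕ (j ⊕ hc) ⊕ e ⊜ ((i ⊕ j ⊕ e) ⊕ hr) ⊕ hc) ↭-refl
      I J [ edge r c ] [ hang r ] [ hang c ]) ⨾
    ⊑-++ˡ _ (unhang [ c ]) ⨾ ↭⇒⊑ (↭-reflexive (++-identityʳ _))

  unhang-but : ∀ {I} (r : A) as → I ++ map hang (r ∷ as) ⊑ I ++ [ hang r ]
  unhang-but {I} r as = ⊑-++ˡ I (⊑-++ˡ [ hang r ] (unhang as))

  open-star : ∀ {I} s → plain s ↭ I → open′ s ⊑ I ++ [ hang (top s) ]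
  open-star (cen c ls)     p = ⊑-++ʳ (map hang (c ∷ ls)) (↭⇒⊑ p) ⨾ unhang-but c ls
  open-star (tip a b l ls) p = ⊑-++ʳ (map hang (a ∷ b ∷ l ∷ ls)) (↭⇒⊑ p) ⨾ unhang-but a (b ∷ l ∷ ls)

  closed-star : ∀ {I} s → plain s ↭ I → closed s ⊑ I ++ [ hang (top s) ]
  closed-star (cen c ls)     p = ⊑-++ʳ (map hang (c ∷ ls)) (↭⇒⊑ p) ⨾ unhang-but c ls
  closed-star (tip a b l ls) p = ⊑-++ʳ (map hang (a ∷ l ∷ ls)) (↭⇒⊑ p) ⨾ unhang-but a (l ∷ ls)

  hang-∈ : ∀ (s : Star A) {p} → p ∈ verts s → hang p ∈ open′ s
  hang-∈ s p∈ = ∈-++⁺ʳ (plain s) (∈-map⁺ hang p∈)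

  top-∈ : ∀ (s : Star A) → top s ∈ verts s
  top-∈ (cen c ls)     = here refl
  top-∈ (tip a b l ls) = here refl

  absorb : ∀ {r c I J I′} → I′ ⊑ I ++ [ hang r ] → Good c (J ++ [ hang c ]) →
           I′ ⊑ (I ++ J ++ [ edge r c ]) ++ [ hang r ]
  absorb {r} {c} {I} {J} p good = p ⨾ hang-rooted (∈-++⁺ʳ I (here refl)) good ⨾
    glue {r} {c} {I} {I ++ [ hang r ]} {J} {J ++ [ hang c ]} ⊑-refl ⊑-refl

  -- A star is enlarged while a core hangs from one of its vertices.
  pend-on : ∀ {r I p v s s′} W Xs → r ≡ top s → NonStar W Xs → p ∈ verts s ⊎ p ∈ verts s′ → Joined s s′ →
            (open′ s ++ open′ s′ ++ [ edge (top s) (top s′) ]) ++ [ edge p v ] ++ coreItems v W Xs ⊑ I ++ [ hang r ] →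
            State r I
  pend-on {p = p} {v} W Xs refl ns p∈ (enlarged s″ top≡ l r _ q) le =
    subst (λ a → State a _) top≡ (pend s″ W Xs (Sum.[ l , r ] p∈) ns
      (subst (λ a → _ ⊑ _ ++ [ hang a ]) (sym top≡) (⊑-++ʳ ([ edge p v ] ++ coreItems v W Xs) (↭⇒⊑ q) ⨾ le)))
  -- As `s` and `s′` together are no longer a star, the old core can be split off at `p`; `open′`
  -- provides `hang p` wherever `p` lies.
  pend-on {p = p} {v} {s} {s′} W Xs refl ns p∈ (core W′ Xs′ ns′ q) le = core W′ Xs′ ns′
    (↭⇒⊑ q ⨾ hang-rooted {I = K} (hang∈ p∈) (good-core Xs ns) ⨾
     ⊑-++ˡ K (↭⇒⊑ (++-comm (coreItems v W Xs) [ edge p v ])) ⨾ le)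
    where
    K = open′ s ++ open′ s′ ++ [ edge (top s) (top s′) ]
    hang∈ : ∀ {p} → p ∈ verts s ⊎ p ∈ verts s′ → hang p ∈ K
    hang∈ (inj₁ p∈) = ∈-++⁺ˡ (hang-∈ s p∈)
    hang∈ (inj₂ p∈) = ∈-++⁺ʳ (open′ s) (∈-++⁺ˡ (hang-∈ s′ p∈))

  joinState : ∀ {r c I J} → State r I → State c J → State r (I ++ J ++ [ edge r c ])
  joinState (whole s p) (whole s′ p′) with joinStar s s′
  ... | enlarged s″ top≡ _ _ q _ = subst (λ a → State a _) top≡
    (whole s″ (↭-trans q (++⁺ p (++⁺ʳ [ edge (top s) (top s′) ] p′))))
  ... | core W Xs ns q = core W Xs ns (↭⇒⊑ q ⨾ glue (open-star s p) (open-star s′ p′))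
  joinState {c = c} (whole s p) (core W Xs ns le) = pend s W Xs (top-∈ s) ns
    (⊑-++ˡ (open′ s) (↭⇒⊑ (++-comm [ edge (top s) c ] (coreItems c W Xs))) ⨾ glue (open-star s p) le)
  joinState (whole s p) (pend {p = q} {v} s′ W Xs q∈ ns le) = pend-on W Xs refl ns (inj₂ q∈) (joinStar s s′)
    (↭⇒⊑ (solve 4 (λ o o′ e f → (o ⊕ o′ ⊕ e) ⊕ f ⊜ o ⊕ (o′ ⊕ f) ⊕ e) ↭-refl
       (open′ s) (open′ s′) [ edge (top s) (top s′) ] (edge q v ∷ coreItems v W Xs)) ⨾
     glue (open-star s p) le)
  -- Nothing hangs from `s` and nothing will, so it may become a closed branch.
  joinState {r} (core W Xs ns le) (whole s p) = core W (s ∷ Xs) (proj₁ ns , λ ())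
    (↭⇒⊑ (solve 5 (λ n w e o xs → n ⊕ w ⊕ (e ⊕ o) ⊕ xs ⊜ (n ⊕ w ⊕ xs) ⊕ o ⊕ e) ↭-refl
       (node r ∷ [ hang r ]) (openBranch r W) [ edge r (top s) ] (closed s) (closedBranches r Xs)) ⨾
     glue le (closed-star s p))
  joinState (pend {p = q} {v} s W Xs q∈ ns le) (whole s′ p) = pend-on W Xs refl ns (inj₁ q∈) (joinStar s s′)
    (↭⇒⊑ (solve 4 (λ o o′ e f → (o ⊕ o′ ⊕ e) ⊕ f ⊜ (o ⊕ f) ⊕ o′ ⊕ e) ↭-refl
       (open′ s) (open′ s′) [ edge (top s) (top s′) ] (edge q v ∷ coreItems v W Xs)) ⨾
     glue le (open-star s′ p))
  -- From here on neither side is a star, and the lower one is split off as a group at the root.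
  joinState (core W Xs ns le) (core W′ Xs′ ns′ le′) = core W Xs ns (absorb le (good-⊑ le′ (good-core Xs′ ns′)))
  joinState (core W Xs ns le) (pend s W′ Xs′ q∈ ns′ le′) = core W Xs ns (absorb le (good-⊑ le′ (good-pend {s = s} Xs′ ns′ q∈)))
  joinState (pend s W Xs q∈ ns le) (core W′ Xs′ ns′ le′) =
    pend s W Xs q∈ ns (absorb le (good-⊑ le′ (good-core Xs′ ns′)))
  joinState (pend s W Xs q∈ ns le) (pend s′ W′ Xs′ q∈′ ns′ le′) =
    pend s W Xs q∈ ns (absorb le (good-⊑ le′ (good-pend {s = s′} Xs′ ns′ q∈′)))

-- Spanning trees

-- Adding one subtree at a time, rather than all children of a vertex at once, leaves a single
-- binary operation for `joinState` to follow.
data Tree (A : Set) : Set where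
  single : A → Tree A
  join   : Tree A → Tree A → Tree A

module _ {A : Set} where

  -- In `join s t`, the root of t is a child of the root of s.
  root : Tree A → A
  root (single a) = a
  root (join s t) = root s

  items : Tree A → List (Item A)
  items (single a) = [ node a ]
  items (join s t) = items s ++ items t ++ [ edge (root s) (root t) ]

  vertices : Tree A → List A
  vertices (single a) = [ a ]
  vertices (join s t) = vertices s ++ vertices t

  nodes-items : ∀ t → nodes (items t) ≡ vertices t
  nodes-items (single a) = refl
  nodes-items (join s t) = trans (nodes-++ (items s) _) (cong₂ _++_ (nodes-items s)
    (trans (nodes-++ (items t) _) (trans (++-identityʳ (nodes (items t))) (nodes-items t))))

  root∈ : ∀ t → root t ∈ vertices t
  root∈ (single a) = here refl
  root∈ (join s t) = ∈-++⁺ˡ (root∈ s)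

  insert : ∀ {u} w t → u ∈ vertices t → ∃[ t′ ] root t′ ≡ root t × items t′ ↭ node w ∷ edge u w ∷ items t
  insert w (single u) (here refl) = join (single u) (single w) , refl , shifts [ node u ] (node w ∷ [ edge u w ])
  insert {u} w (join s t) u∈ with ∈-++⁻ (vertices s) u∈
  ... | inj₁ u∈s = let s′ , r , p = insert w s u∈s in join s′ t ,  r ,
    subst (λ a → items s′ ++ items t ++ [ edge a (root t) ] ↭ node w ∷ edge u w ∷ items (join s t)) (sym r) (++⁺ʳ _ p)
  ... | inj₂ u∈t = let t′ , r , p = insert w t u∈t in join s t′ , refl ,
    subst (λ a → items s ++ items t′ ++ [ edge (root s) a ] ↭ node w ∷ edge u w ∷ items (join s t)) (sym r)
      (↭-trans (++⁺ˡ (items s) (++⁺ʳ _ p)) (shifts (items s) (node w ∷ [ edge u w ])))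

  data Path (R : A → A → Set) : A → A → List A → Set where
    stop : ∀ {a} → Path R a a [ a ]
    _∷_  : ∀ {a b c as} → R a b → Path R b c as → Path R a c (a ∷ as)

  path-map : ∀ {R S : A → A → Set} → (∀ {a b} → R a b → S a b) → ∀ {a b as} → Path R a b as → Path S a b as
  path-map f stop    = stop
  path-map f (r ∷ p) = f r ∷ path-map f p

  path-++ : ∀ {R : A → A → Set} {a b c d as bs} → Path R a b as → R b c → Path R c d bs → Path R a d (as ++ bs)
  path-++ stop    r q = r ∷ q
  path-++ (s ∷ p) r q = s ∷ path-++ p r q

  path-linked : ∀ {R : A → A → Set} {a b c as} → Path R a b as → R b c → Linked R (as ++ [ c ])
  path-linked stop          r = r ∷ [-]
  path-linked (s ∷ stop)    r = s ∷ path-linked stop r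
  path-linked (s ∷ (t ∷ p)) r = s ∷ path-linked (t ∷ p) r

  SimplePath : Tree A → A → A → Set
  SimplePath t a b = ∃[ as ] Path (IsEdge (items t)) a b as × Unique as × (∀ {c} → c ∈ as → c ∈ vertices t)

  simple-path : ∀ t → Unique (vertices t) → ∀ {a b} → a ∈ vertices t → b ∈ vertices t → SimplePath t a b
  simple-path (single a) u (here refl) (here refl) = [ a ] , stop , [] ∷ [] , id
  simple-path (join s t) u a∈ b∈ = cases (∈-++⁻ (vertices s) a∈) (∈-++⁻ (vertices s) b∈)
    where
    us = proj₁ (++-unique⁻ (vertices s) u)
    ut = proj₁ (proj₂ (++-unique⁻ (vertices s) u))
    disjoint = proj₂ (proj₂ (++-unique⁻ (vertices s) u))
    in-s : ∀ {a b} → IsEdge (items s) a b → IsEdge (items (join s t)) a b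
    in-s = Sum.map ∈-++⁺ˡ ∈-++⁺ˡ
    in-t : ∀ {a b} → IsEdge (items t) a b → IsEdge (items (join s t)) a b
    in-t = Sum.map (∈-++⁺ʳ (items s) ∘ ∈-++⁺ˡ) (∈-++⁺ʳ (items s) ∘ ∈-++⁺ˡ)
    link : edge (root s) (root t) ∈ items (join s t)
    link = ∈-++⁺ʳ (items s) (∈-++⁺ʳ (items t) (here refl))
    cases : ∀ {a b} → a ∈ vertices s ⊎ a ∈ vertices t → b ∈ vertices s ⊎ b ∈ vertices t → SimplePath (join s t) a b
    cases (inj₁ a∈) (inj₁ b∈) = let as , p , v , ⊆ = simple-path s us a∈ b∈ in
      as , path-map in-s p , v , ∈-++⁺ˡ ∘ ⊆
    cases (inj₂ a∈) (inj₂ b∈) = let as , p , v , ⊆ = simple-path t ut a∈ b∈ in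
      as , path-map in-t p , v , ∈-++⁺ʳ (vertices s) ∘ ⊆
    cases (inj₁ a∈) (inj₂ b∈) =
      let as , p , v , ⊆ = simple-path s us a∈ (root∈ s)
          bs , q , w , ⊆′ = simple-path t ut (root∈ t) b∈ in
      as ++ bs , path-++ (path-map in-s p) (inj₁ link) (path-map in-t q) ,
      Unique.++⁺ v w (λ (c∈ , c∈′) → disjoint (⊆ c∈ , ⊆′ c∈′)) ,
      (λ c∈ → Sum.[ ∈-++⁺ˡ ∘ ⊆ , ∈-++⁺ʳ (vertices s) ∘ ⊆′ ] (∈-++⁻ as c∈))
    cases (inj₂ a∈) (inj₁ b∈) =
      let as , p , v , ⊆ = simple-path t ut a∈ (root∈ t)
          bs , q , w , ⊆′ = simple-path s us (root∈ s) b∈ in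
      as ++ bs , path-++ (path-map in-t p) (inj₂ link) (path-map in-s q) ,
      Unique.++⁺ v w (λ (c∈ , c∈′) → disjoint (⊆′ c∈′ , ⊆ c∈)) ,
      (λ c∈ → Sum.[ ∈-++⁺ʳ (vertices s) ∘ ⊆ , ∈-++⁺ˡ ∘ ⊆′ ] (∈-++⁻ as c∈))

  unique-length : ∀ {as bs : List A} → Unique as → (∀ {a} → a ∈ as → a ∈ bs) → length as ≤ length bs
  unique-length []            ⊆ = z≤n
  unique-length {a ∷ as} (a∉ ∷ u) ⊆ with ys , zs , refl ← ∈-∃++ (⊆ (here refl)) =
    subst (suc (length as) ≤_) (sym (↭-length (shift a ys zs))) (s≤s (unique-length u rest))
    where
    rest : ∀ {b} → b ∈ as → b ∈ ys ++ zs
    rest b∈ with ∈-resp-↭ (shift a ys zs) (⊆ (there b∈))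
    ... | here refl = ⊥-elim (All.lookup a∉ b∈ refl)
    ... | there b∈′ = b∈′

  lookup-injective : ∀ {as : List A} → Unique as → ∀ i j → lookup as i ≡ lookup as j → i ≡ j
  lookup-injective (_ ∷ _)  zero    zero    _ = refl
  lookup-injective (a∉ ∷ _) zero    (suc j) e = ⊥-elim (All.lookup a∉ (∈-lookup j) e)
  lookup-injective (a∉ ∷ _) (suc i) zero    e = ⊥-elim (All.lookup a∉ (∈-lookup i) (sym e))
  lookup-injective (_ ∷ u)  (suc i) (suc j) e = cong suc (lookup-injective u i j e)

-- Distances and spanning subtrees of the given graph

least : {P : ℕ → Set} → (∀ k → Dec (P k)) → ∀ k → P k → ∃[ d ] P d × (∀ {j} → P j → d ≤ j) × d ≤ k
least P? zero    p = zero , p , (λ _ → z≤n) , z≤n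
least P? (suc k) p with P? zero
... | yes p₀ = zero , p₀ , (λ _ → z≤n) , z≤n
... | no ¬p₀ = let d , q , min , le = least (P? ∘ suc) k p in
  suc d , q , (λ { {zero} p₀ → ⊥-elim (¬p₀ p₀) ; {suc j} pj → s≤s (min pj) }) , s≤s le

module Span {n : ℕ} (G : Graph n) where
  open Graph G using (Adj; adj?; irrefl) renaming (sym to adj-sym)
  open Placement Adj adj-sym using (Edges; Within; stay; step)

  walk? : ∀ k u v → Dec (Walk G u v k)
  walk? zero    u v = map′ (λ { refl → nil }) (λ { nil → refl }) (u Fin.≟ v)
  walk? (suc k) u v = map′ (λ (w , a , p) → cons a p) (λ { (cons a p) → _ , a , p })
    (Fin.any? λ w → adj? u w ×-dec walk? k w v)

  within⇒walk : ∀ {k u v} → Within k u v → ∃[ j ] Walk G u v j × j ≤ k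
  within⇒walk stay       = zero , nil , z≤n
  within⇒walk (step a p) = let j , w , le = within⇒walk p in suc j , cons a w , s≤s le

  -- `Dist≤` asks for a shortest walk; it is found by testing the lengths up to that of a given one.
  within⇒dist : ∀ {k u v} → Within k u v → Dist≤ G u v k
  within⇒dist {u = u} {v} p =
    let j , w , le = within⇒walk p
        d , q , min , le′ = least (λ k → walk? k u v) j w
    in d , (q , min) , ℕ.≤-trans le′ le

  record Subtree (x : Fin n) : Set where
    field
      tree   : Tree (Fin n)
      root≡  : root tree ≡ x
      unique : Unique (vertices tree)
      edges  : Edges (items tree)

  open Subtree

  extend : ∀ {x u w} (S : Subtree x) → u ∈ vertices (tree S) → w ∉ vertices (tree S) → Adj u w →
           ∃[ S′ ] vertices (tree {x} S′) ↭ w ∷ vertices (tree S)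
  extend {x} {u} {w} S u∈ w∉ a =
    let t′ , r , p = insert w (tree S) u∈
        q = subst₂ _↭_ (nodes-items t′) (cong (w ∷_) (nodes-items (tree S))) (mapMaybe-↭ node? p)
    in record
      { tree   = t′
      ; root≡  = trans r (root≡ S)
      ; unique = unique-resp-↭ (↭-sym q) (All.tabulate (λ v∈ e → w∉ (subst (_∈ vertices (tree S)) (sym e) v∈)) ∷ unique S)
      ; edges  = λ e → adj (∈-resp-↭ p e)
      } , q
    where
    adj : ∀ {c d} → edge c d ∈ node w ∷ edge u w ∷ items (tree S) → Adj c d
    adj (there (here refl)) = a
    adj (there (there e))   = edges S e

  Extension : ∀ {x} → Subtree x → (Fin n → Set) → Set
  Extension {x} S P = Σ[ S′ ∈ Subtree x ] (∀ {v} → v ∈ vertices (tree S) → v ∈ vertices (tree S′)) ×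
                                          (∀ {v} → P v → v ∈ vertices (tree S′))

  -- Only a step of the walk that leaves the current subtree adds a vertex, so no cycle arises.
  extend-along : ∀ {x u v k} (S : Subtree x) → u ∈ vertices (tree S) → Walk G u v k → Extension S (_≡ v)
  extend-along S u∈ nil = S , id , λ { refl → u∈ }
  extend-along S u∈ (cons {v = w} a p) with any? (w Fin.≟_) (vertices (tree S))
  ... | yes w∈ = extend-along S w∈ p
  ... | no w∉  =
    let S′ , q = extend S u∈ w∉ a
        S″ , ⊆ , v∈ = extend-along S′ (∈-resp-↭ (↭-sym q) (here refl)) p
    in S″ , ⊆ ∘ ∈-resp-↭ (↭-sym q) ∘ there , v∈

  extend-to : ∀ {x} → Connected G → (S : Subtree x) → ∀ vs → Extension S (_∈ vs)
  extend-to c S []       = S , id , λ ()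
  extend-to {x} c S (v ∷ vs) =
    let S′ , ⊆ , v∈ = extend-along S (subst (_∈ vertices (tree S)) (root≡ S) (root∈ (tree S))) (proj₂ (c x v))
        S″ , ⊆′ , vs⊆ = extend-to c S′ vs
    in S″ , ⊆′ ∘ ⊆ , λ { (here e) → ⊆′ (v∈ e) ; (there p) → vs⊆ p }

  span : Connected G → ∀ x → ∃[ S ] (∀ v → v ∈ vertices (tree {x} S))
  span c x =
    let S , _ , all = extend-to c record
          { tree = single x ; root≡ = refl ; unique = [] ∷ [] ; edges = λ { (here ()) ; (there ()) } } (allFin n)
    in S , λ v → all (∈-allFin v)

  -- Otherwise the edge would close the simple path between its ends, which has at least three
  -- vertices, to a cycle.
  adj⇒edge : Acyclic G → ∀ {x} (S : Subtree x) → (∀ v → v ∈ vertices (tree S)) →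
             ∀ {a b} → Adj a b → IsEdge (items (tree S)) a b
  adj⇒edge acyclic S all {a} {b} e with simple-path (tree S) (unique S) (all a) (all b)
  ... | _ , stop , _ , _              = ⊥-elim (irrefl e)
  ... | _ , (i ∷ stop) , _ , _        = i
  ... | as , p@(_ ∷ (_ ∷ q)) , u , _ = ⊥-elim (acyclic as (long q) (u , path-linked (path-map adj p) (adj-sym e)))
    where
    adj : ∀ {c d} → IsEdge (items (tree S)) c d → Adj c d
    adj (inj₁ i) = edges S i
    adj (inj₂ i) = adj-sym (edges S i)
    long : ∀ {R : Fin n → Fin n → Set} {a b as} → Path R a b as → 3 ≤ 2 + length as
    long stop    = s≤s (s≤s (s≤s z≤n))
    long (_ ∷ _) = s≤s (s≤s (s≤s z≤n))

  record Centred (b : Fin n) (ls : List (Fin n)) : Set where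
    field
      distinct : Unique (b ∷ ls)
      all∈     : ∀ v → v ∈ b ∷ ls
      leaf     : ∀ {l} → l ∈ ls → Adj b l
      only     : ∀ {u v} → Adj u v → u ≡ b ⊎ v ≡ b

  centred⇒star : ∀ {b ls} → Centred b ls → G ≅ star (length ls)
  centred⇒star {b} {ls} C = permutation to from to-from (λ v → sym (lookup-index (all∈ v))) ,
    λ u v → mk⇔ (adj⇒star (all∈ u) (all∈ v)) (star⇒adj (all∈ u) (all∈ v))
    where
    open Centred C
    to : Fin n → Fin (suc (length ls))
    to v = index (all∈ v)
    from : Fin (suc (length ls)) → Fin n
    from = lookup (b ∷ ls)
    to-from : ∀ i → to (from i) ≡ i
    to-from i = lookup-injective distinct (to (from i)) i (sym (lookup-index (all∈ (from i))))
    b∉ : b ∉ ls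
    b∉ = Unique.Unique[x∷xs]⇒x∉xs distinct
    adj⇒star : ∀ {u v} (p : u ∈ b ∷ ls) (q : v ∈ b ∷ ls) → Adj u v → StarAdj (index p) (index q)
    adj⇒star (here refl) (here refl) e = ⊥-elim (irrefl e)
    adj⇒star (here _)    (there _)   e = centre-leaf
    adj⇒star (there _)   (here _)    e = leaf-centre
    adj⇒star (there p)   (there q)   e with only e
    ... | inj₁ refl = ⊥-elim (b∉ p)
    ... | inj₂ refl = ⊥-elim (b∉ q)
    star⇒adj : ∀ {u v} (p : u ∈ b ∷ ls) (q : v ∈ b ∷ ls) → StarAdj (index p) (index q) → Adj u v
    star⇒adj (here refl) (there q)   _ = leaf q
    star⇒adj (there p)   (here refl) _ = adj-sym (leaf p)
    star⇒adj (here _)    (here _)    ()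
    star⇒adj (there _)   (there _)   ()

-- Placing the whole tree

module Realise {n : ℕ} (G : Graph n) where
  open Graph G using (Adj; adj?; irrefl) renaming (sym to adj-sym)
  open Placement Adj adj-sym
  open Span G
  open Reduction Adj adj-sym

  state : ∀ t → State (root t) (items t)
  state (single a) = whole (cen a []) ↭-refl
  state (join s t) = joinState (state s) (state t)

  leafEdge : ∀ {b c l : Fin n} ls → edge c l ∈ leafItems b ls → c ≡ b × l ∈ ls
  leafEdge (l ∷ ls) (there (here refl)) = refl , here refl
  leafEdge (l ∷ ls) (there (there e))   = let p , q = leafEdge ls e in p , there q

  leafEdge⁺ : ∀ {b l : Fin n} {ls} → l ∈ ls → edge b l ∈ leafItems b ls
  leafEdge⁺ (here refl) = there (here refl)
  leafEdge⁺ (there l∈)  = there (there (leafEdge⁺ l∈))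

  nodes-leaves : ∀ (b : Fin n) ls → nodes (leafItems b ls) ≡ ls
  nodes-leaves b []       = refl
  nodes-leaves b (l ∷ ls) = cong (l ∷_) (nodes-leaves b ls)

  star-tree : ∀ {x} (S : Subtree x) → (∀ v → v ∈ vertices (Subtree.tree S)) →
              (∀ {a b} → Adj a b → IsEdge (items (Subtree.tree S)) a b) →
              ∀ s → plain s ↭ items (Subtree.tree S) → ∃[ m ] G ≅ star m
  star-tree S all is-edge s p = centre s p
    where
    open Subtree S
    perm : ∀ {I} → I ↭ items tree → nodes I ↭ vertices tree
    perm q = ↭-trans (mapMaybe-↭ node? q) (↭-reflexive (nodes-items tree))
    centre : ∀ s → plain s ↭ items tree → ∃[ m ] G ≅ star m
    centre (cen c ls) p = length ls , centred⇒star record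
      { distinct = unique-resp-↭ (↭-sym q) unique
      ; all∈     = λ v → ∈-resp-↭ (↭-sym q) (all v)
      ; leaf     = λ l∈ → edges (∈-resp-↭ p (there (leafEdge⁺ l∈)))
      ; only     = λ e → Sum.map at at (is-edge e)
      }
      where
      q : c ∷ ls ↭ vertices tree
      q = subst (λ ns → c ∷ ns ↭ vertices tree) (nodes-leaves c ls) (perm p)
      at : ∀ {u v} → edge u v ∈ items tree → u ≡ c
      at e with there e′ ← ∈-resp-↭ (↭-sym p) e = proj₁ (leafEdge ls e′)
    -- Here `b` is the centre, and the top `a` counts as a leaf.
    centre (tip a b l ls) p = length (a ∷ l ∷ ls) , centred⇒star record
      { distinct = unique-resp-↭ (↭-sym q) unique
      ; all∈     = λ v → ∈-resp-↭ (↭-sym q) (all v)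
      ; leaf     = λ { (here refl) → adj-sym (edges (∈-resp-↭ p (there (here refl))))
                     ; (there l∈)  → edges (∈-resp-↭ p (there (there (there (leafEdge⁺ l∈))))) }
      ; only     = only ∘ is-edge
      }
      where
      q : b ∷ a ∷ l ∷ ls ↭ vertices tree
      q = ↭-trans (swap b a ↭-refl)
            (subst (λ ns → a ∷ b ∷ l ∷ ns ↭ vertices tree) (nodes-leaves b ls) (perm p))
      at : ∀ {u v} → edge u v ∈ items tree → u ≡ b ⊎ v ≡ b
      at e with ∈-resp-↭ (↭-sym p) e
      ... | there (here refl)       = inj₂ refl
      ... | there (there (there e′)) = inj₁ (proj₁ (leafEdge (l ∷ ls) e′))
      only : ∀ {u v} → IsEdge (items tree) u v → u ≡ b ⊎ v ≡ b
      only (inj₁ e) = at e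
      only (inj₂ e) = Sum.swap (at e)

  good-tree : ∀ {x} (S : Subtree x) → (∀ v → v ∈ vertices (Subtree.tree S)) →
              (∀ {a b} → Adj a b → IsEdge (items (Subtree.tree S)) a b) → (∀ m → ¬ (G ≅ star m)) →
              Good x (items (Subtree.tree S) ++ [ hang x ])
  good-tree {x} S all is-edge non-star =
    subst (λ r → Good r (items tree ++ [ hang r ])) root≡ (from-state (state tree) refl)
    where
    open Subtree S
    from-state : ∀ {r I} → State r I → I ≡ items tree → Good r (I ++ [ hang r ])
    from-state (whole s p) refl           = let m , f = star-tree S all is-edge s p in ⊥-elim (non-star m f)
    from-state (core W Xs ns le) _       = good-⊑ le (good-core Xs ns)
    from-state (pend s W Xs p∈ ns le) _  = good-⊑ le (good-pend {s = s} Xs ns p∈)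

-- From lists of cycles to a permutation

module Permute {n : ℕ} (cs : List (List (Fin n))) (vs : List (Fin n))
               (cover : concat cs ↭ vs) (unique : Unique vs) (all∈ : ∀ v → v ∈ vs) where

  M : List (Fin n × Fin n)
  M = allSteps cs

  sources-↭ : map proj₁ M ↭ vs
  sources-↭ = ↭-trans (↭-reflexive (allSteps-sources cs)) cover

  targets-↭ : map proj₂ M ↭ vs
  targets-↭ = ↭-trans (allSteps-targets cs) cover

  image : ∀ v → ∃[ v′ ] (v , v′) ∈ M
  image v with _ , m , refl ← ∈-map⁻ proj₁ (∈-resp-↭ (↭-sym sources-↭) (all∈ v)) = _ , m

  preimage : ∀ v → ∃[ v′ ] (v′ , v) ∈ M
  preimage v with _ , m , refl ← ∈-map⁻ proj₂ (∈-resp-↭ (↭-sym targets-↭) (all∈ v)) = _ , m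

  functional : ∀ {u v w} → (u , v) ∈ M → (u , w) ∈ M → v ≡ w
  functional m m′ = cong proj₂ (injective-on proj₁ (unique-resp-↭ (↭-sym sources-↭) unique) m m′ refl)

  injective : ∀ {u v w} → (u , w) ∈ M → (v , w) ∈ M → u ≡ v
  injective m m′ = cong proj₁ (injective-on proj₂ (unique-resp-↭ (↭-sym targets-↭) unique) m m′ refl)

  σ : Permutation′ n
  σ = permutation (proj₁ ∘ image) (proj₁ ∘ preimage)
    (λ v → functional (proj₂ (image (proj₁ (preimage v)))) (proj₂ (preimage v)))
    (λ v → injective (proj₂ (preimage (proj₁ (image v)))) (proj₂ (image v)))

  σ-step : ∀ v → (v , σ ⟨$⟩ʳ v) ∈ M
  σ-step v = proj₂ (image v)

  closed-cycle : ∀ {c u} → c ∈ cs → u ∈ c → σ ⟨$⟩ʳ u ∈ c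
  closed-cycle {c} {u} c∈ u∈ with (_ , u′) , m , refl ← ∈-map⁻ proj₁ (subst (u ∈_) (sym (steps-sources c)) u∈) =
    subst (_∈ c) (functional (∈-concat⁺′ m (∈-map⁺ steps c∈)) (σ-step u))
      (∈-resp-↭ (steps-targets c) (∈-map⁺ proj₂ m))

  stays : ∀ {c u us} → c ∈ cs → u ∈ c → Linked (λ u v → σ ⟨$⟩ʳ u ≡ v) (u ∷ us) → ∀ {v} → v ∈ u ∷ us → v ∈ c
  stays c∈ u∈ _           (here refl) = u∈
  stays c∈ u∈ (refl ∷ ls) (there v∈)  = stays c∈ (closed-cycle c∈ u∈) ls v∈

  -- A cycle of `σ` cannot leave the list in `cs` that contains its first vertex, and its vertices
  -- are distinct.
  cycle-length : All (λ c → length c ≤ 5) cs → ∀ us → IsCycle σ us → length us ≤ 5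
  cycle-length short (v ∷ us) (u , linked)
    with c , v∈ , c∈ ← ∈-concat⁻′ cs (∈-resp-↭ (↭-sym cover) (all∈ v)) =
    ℕ.≤-trans (unique-length u (stays c∈ v∈ linked ∘ ∈-++⁺ˡ)) (All.lookup short c∈)

theorem1p7 : (n : ℕ) (T : Graph n) → IsNonStarTree T → (x : Fin n) →
    Σ[ σ ∈ Permutation′ n ] IsWell2Placement T x σ
theorem1p7 n T nonStarTree x = σ , record
  { fixedPointFree = λ v e → P.moves (σ-step v) (sym e)
  ; is2Placement   = λ {a} {b} e e′ → apart (is-edge e) (is-edge e′)
  ; imageInPower   = λ e → within⇒dist (image-within (is-edge e))
  ; dist-root      = within⇒dist (R.near-root (σ-step x))
  ; dist-neighbour = λ {y} e → within⇒dist (R.near-nbr (is-edge e) (σ-step y))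
  ; dist-leaf      = λ {y} _ → within⇒dist (P.near (σ-step y))
  ; cycles         = cycle-length P.short
  }
  where
  open IsNonStarTree nonStarTree
  open IsTree isTree
  open Graph T using (Adj) renaming (sym to adj-sym)
  open Placement Adj adj-sym
  open Span T
  open Realise T
  S    = proj₁ (span connected x)
  all∈ = proj₂ (span connected x)
  I    = items (Subtree.tree S) ++ [ hang x ]

  nodes-I : nodes I ≡ vertices (Subtree.tree S)
  nodes-I = trans (nodes-++ (items (Subtree.tree S)) [ hang x ]) (trans (++-identityʳ _) (nodes-items (Subtree.tree S)))

  edges-I : Edges I
  edges-I e with ∈-++⁻ (items (Subtree.tree S)) e
  ... | inj₁ e′ = Subtree.edges S e′
  ... | inj₂ (here ())

  is-edge : ∀ {a b} → Adj a b → IsEdge I a b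
  is-edge e = Sum.map ∈-++⁺ˡ ∈-++⁺ˡ (adj⇒edge acyclic S all∈ e)

  unique : Unique (nodes I)
  unique = subst Unique (sym nodes-I) (Subtree.unique S)

  placement : ∃[ cs ] Placed I cs × Rooted x I cs
  placement = good-tree S all∈ (adj⇒edge acyclic S all∈) nonStar unique edges-I

  cs = proj₁ placement
  module P = Placed (proj₁ (proj₂ placement))
  module R = Rooted (proj₂ (proj₂ placement))
  open Permute cs (nodes I) P.cover unique (λ v → subst (v ∈_) (sym nodes-I) (all∈ v))

  apart : ∀ {a b} → IsEdge I a b → ¬ IsEdge I (σ ⟨$⟩ʳ a) (σ ⟨$⟩ʳ b)
  apart {a} {b} (inj₁ e) = P.apart e (σ-step a) (σ-step b)
  apart {a} {b} (inj₂ e) = P.apart e (σ-step b) (σ-step a) ∘ Sum.swap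

  image-within : ∀ {a b} → IsEdge I a b → Within 6 (σ ⟨$⟩ʳ a) (σ ⟨$⟩ʳ b)
  image-within {a} {b} (inj₁ e) = P.image e (σ-step a) (σ-step b)
  image-within {a} {b} (inj₂ e) = within-sym (P.image e (σ-step b) (σ-step a))
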